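{- Any CONGEST algorithm (possibly randomized, succeeding with probability at least $2/3$) that, given a directed unweighted $n$-vertex graph of undirected diameter $D$ and two vertices $s,t$, decides whether $t$ is reachable from $s$, or computes the $s$-$t$ shortest path distance, requires $\Omega\!\left(\frac{\sqrt{n}}{\log n}+D\right)$ rounds in the worst case.
   Context: CONGEST model: the communication network is the graph $G=(V,E)$, $n=|V|$; each node has a unique identifier in $\{0,\dots,n-1\}$, knows its own and its neighbours' identifiers and its incident edges (with their directions); computation proceeds in synchronous rounds in which each node may send a message of $O(\log n)$ bits to each neighbour; local computation is free; communication links are bidirectional even when $G$ is directed. The undirected diameter $D$ is the diameter of the underlying undirected unweighted graph of $G$.
   Formalization: The bound is proved for every undirected diameter D with C·log n ≤ D ≤ n−1, C an absolute constant; for literally all D it fails (for D = 1, in- and out-degrees determine reachability in O(1) rounds). -}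

module Defs where

open import Data.Bool.Base using (Bool; true; false; T; _∨_; if_then_else_)
open import Data.Fin.Base using (Fin; finToFun)
open import Data.Fin.Subset using (Subset; _∈_; ∣_∣)
open import Data.Maybe.Base using (Maybe; just; nothing)
open import Data.Nat.Base using (ℕ; zero; suc; _*_; _∸_; _^_; _≤_; _<_; z≤n; NonZero)
open import Data.Nat.Logarithm using (⌈log₂_⌉)
open import Data.Product.Base using (Σ-syntax; ∃-syntax; _×_; _,_)
open import Data.Sum.Base using (_⊎_; inj₁; inj₂)
open import Data.Vec.Base using (Vec; []; tabulate)
open import Data.Vec.Bounded.Base using (Vec≤; _,_)
open import Relation.Binary.Construct.Closure.ReflexiveTransitive using (Star; fold)
open import Relation.Binary.PropositionalEquality.Core using (_≡_)
open import Relation.Nullary.Negation.Core using (¬_)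
open import Relation.Nullary.Reflects using (Reflects)

record Digraph (n : ℕ) : Set where
  field
    edge     : Fin n → Fin n → Bool
    loopless : ∀ v → edge v v ≡ false

  link : Fin n → Fin n → Bool
  link u v = edge u v ∨ edge v u

  Edge : Fin n → Fin n → Set
  Edge u v = T (edge u v)

  Link : Fin n → Fin n → Set
  Link u v = T (link u v)

open Digraph

length : {V : Set} {E : V → V → Set} {u v : V} → Star E u v → ℕ
length = fold (λ _ _ → ℕ) (λ _ → suc) 0

-- No d satisfies this when v is unreachable from u.
IsDistance : {V : Set} (E : V → V → Set) → V → V → ℕ → Set
IsDistance E u v d =
  (Σ[ p ∈ Star E u v ] length p ≡ d) × ((p : Star E u v) → d ≤ length p)

-- In particular the underlying undirected graph is connected.
HasUndirectedDiameter : ∀ {n} → Digraph n → ℕ → Set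
HasUndirectedDiameter G D =
  (∀ u v → ∃[ d ] (IsDistance (Link G) u v d × d ≤ D)) ×
  (∃[ u ] ∃[ v ] IsDistance (Link G) u v D)

data Problem : Set where
  reachability distance : Problem

-- For distance, `nothing` stands for ∞.
Answer : Problem → Set
Answer reachability = Bool
Answer distance     = Maybe ℕ

Correct : ∀ {n} (P : Problem) → Digraph n → Fin n → Fin n → Answer P → Set
Correct reachability G s t b        = Reflects (Star (Edge G) s t) b
Correct distance     G s t (just d) = IsDistance (Edge G) s t d
Correct distance     G s t nothing  = ¬ Star (Edge G) s t

-- At most b bits; the empty message plays the role of silence.
Message : ℕ → Set
Message b = Vec≤ Bool b

silence : ∀ {b} → Message b
silence = [] , z≤n

-- What a node knows at the start.  The identifier of a node is its name in
-- Fin n.  Vectors rather than functions are used here and for inboxes so that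
-- pointwise equal data are propositionally equal.
record LocalInput (n : ℕ) : Set where
  field
    self            : Fin n
    source target   : Fin n
    outNbrs inNbrs  : Subset n

localInput : ∀ {n} → Digraph n → Fin n → Fin n → Fin n → LocalInput n
localInput G s t v = record
  { self    = v
  ; source  = s
  ; target  = t
  ; outNbrs = tabulate λ u → edge G v u
  ; inNbrs  = tabulate λ u → edge G u v
  }

-- A node is either running (inj₁) or has halted (inj₂), the latter with or
-- without announcing an answer.  Since an algorithm is given for one n at a
-- time, n is known to the nodes.  Each node privately draws a uniform element
-- of Fin coins before the first round; coins = 1 is the deterministic case.
record Algorithm (A : Set) (n b : ℕ) : Set₁ where
  field
    State   : Set
    coins   : ℕ
    .{{coins≢0}} : NonZero coins
    init    : LocalInput n → Fin coins → State ⊎ Maybe A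
    send    : State → Fin n → Message b
    receive : State → Vec (Message b) n → State ⊎ Maybe A

  Node : Set
  Node = State ⊎ Maybe A

  message : Node → Fin n → Message b
  message (inj₁ x) v = send x v
  message (inj₂ _) v = silence

  inbox : Digraph n → (Fin n → Node) → Fin n → Vec (Message b) n
  inbox G c v = tabulate λ u → if link G u v then message (c u) v else silence

  update : Node → Vec (Message b) n → Node
  update (inj₁ x) ms = receive x ms
  update (inj₂ o) ms = inj₂ o

  -- Joint outcomes of the n independent draws.
  Outcome : Set
  Outcome = Fin (coins ^ n)

  after : ℕ → Digraph n → Fin n → Fin n → Outcome → Fin n → Node
  after zero    G s t ω v = init (localInput G s t v) (finToFun ω v)
  after (suc r) G s t ω v = update (after r G s t ω v) (inbox G (after r G s t ω) v)

  HaltsWithin : ℕ → Digraph n → Fin n → Fin n → Outcome → Set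
  HaltsWithin r G s t ω = ∀ v → ∃[ o ] after r G s t ω v ≡ inj₂ o

  -- Some node announces an answer, and every announced answer is right.  This
  -- covers the conventions that s, that t, or that every node must know it.
  Succeeds : (A → Set) → ℕ → Digraph n → Fin n → Fin n → Outcome → Set
  Succeeds Right r G s t ω =
    (∃[ v ] ∃[ a ] after r G s t ω v ≡ inj₂ (just a)) ×
    (∀ v a → after r G s t ω v ≡ inj₂ (just a) → Right a)

-- Probability at least 2/3 under the uniform distribution on Fin N.
WithProb≥2/3 : ∀ {N} → (Fin N → Set) → Set
WithProb≥2/3 {N} E =
  Σ[ S ∈ Subset N ] ((∀ {ω} → ω ∈ S → E ω) × 2 * N ≤ 3 * ∣ S ∣)

-- r bounds the worst-case number of rounds, over inputs and coin tosses, on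
-- n-vertex graphs of undirected diameter D.  Halted nodes never change, so
-- judging success after r rounds is judging the final outputs.
SolvesWithin : (P : Problem) {n b : ℕ} (D r : ℕ) → Algorithm (Answer P) n b → Set
SolvesWithin P {n} D r 𝒜 =
  (G : Digraph n) → HasUndirectedDiameter G D → (s t : Fin n) →
  (∀ ω → HaltsWithin r G s t ω) ×
  WithProb≥2/3 (Succeeds (Correct P G s t) r G s t)
  where open Algorithm 𝒜

-- For n ≥ 2 this is the real inequality x ≥ √n / ⌈log₂ n⌉ + D, cleared of
-- the division and the square root.
_≥√_/log+_ : ℕ → ℕ → ℕ → Set
x ≥√ n /log+ D = D ≤ x × n ≤ ((x ∸ D) * ⌈log₂ n ⌉) ^ 2

module Submission where

{-
The two terms are bounded separately.

Diameter term.  On the line 0, …, D, whether the first and the last link may be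
traversed forwards decides whether D is reachable from 0, and in fewer than
about D / 4 rounds no vertex learns about both.  The algorithm would have to
succeed on three of the four inputs with probability 2/3 each but never on all
three at once.  With shared coins this is just barely possible; private coins
of the two halves of the line can be spliced, which rules it out.

Square root term.  A width-two branching program for the inner product modulo 2
of x and y is laid out on long parallel rows between the holder of x (column 0)
and the holder of y (column ℓ), so that t is reachable from s iff the inner
product is 1.  A binary tree above the columns makes the graph shallow.  If
2 r < ℓ, the two sides can simulate r rounds, each giving up one column per
round; only the at most one link per tree level that crosses the current cut
has to be communicated, so the run is described by O(r log n) messages.  The
fibres of this transcript are rectangles, on which the inner product is
balanced by Parseval's identity, whence a transcript of fewer than about m / 2
bits cannot predict the inner product of m bits with probability 2/3.  For
ℓ = 2 r + 1 and m of order r log² n this is a contradiction, so the graph does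
not fit into n vertices, that is, n = O((r log n)²).  A line of D + 1 vertices
attached by its middle makes the diameter exactly D.
-}

open import Defs
open import Data.Bool.Base using (Bool; true; false; not; T; _∧_; _∨_; _xor_; if_then_else_)
import Data.Bool.Properties as Bool
open import Data.Empty using (⊥)
open import Data.Fin.Base using (Fin; zero; suc; toℕ; fromℕ<; combine; finToFun; funToFin)
import Data.Fin.Properties as Fin
open import Data.Fin.Subset using (Subset; ∣_∣; inside; outside; _∈_; _∉_)
open import Data.Fin.Subset.Properties using (_∈?_)
open import Data.Integer.Base as ℤ using (ℤ; +_; 0ℤ; 1ℤ; -1ℤ)
import Data.Integer.Properties as ℤ
import Data.Integer.Tactic.RingSolver as ℤ-Solver
open import Data.List.Base as List using (List; []; _∷_; _++_; map; allFin)
import Data.List.Properties as List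
open import Data.Maybe.Base using (just; nothing)
open import Data.Nat.Base
  using (ℕ; zero; suc; pred; _+_; _*_; _∸_; _^_; _≤_; _<_; z≤n; s≤s; _≤′_; ≤′-refl; ≤′-step;
         ⌊_/2⌋; ⌈_/2⌉; NonZero; >-nonZero; >-nonZero⁻¹)
open import Data.Nat.Induction using (<-rec)
open import Data.Nat.Logarithm using (⌈log₂_⌉; ⌈log₂⌉-mono-≤; ⌈log₂⌈n/2⌉⌉≡⌈log₂n⌉∸1)
import Data.Nat.Properties as ℕ
import Data.Nat.Tactic.RingSolver as ℕ-Solver
open import Data.Product.Base using (Σ; Σ-syntax; ∃; ∃-syntax; _×_; _,_; proj₁; proj₂)
open import Data.Product.Function.NonDependent.Propositional using (_×-↔_)
open import Data.Sum.Base using (_⊎_; inj₁; inj₂)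
open import Data.Sum.Function.Propositional using (_⊎-↔_)
open import Data.Unit.Base using (⊤)
open import Data.Vec.Base using (Vec; []; _∷_; lookup)
open import Data.Vec.Bounded.Base using (isBounded) renaming (_,_ to bounded)
import Data.Vec.Properties as Vec
open import Function.Base using (_∘_; id)
open import Function.Bundles using (mk⇔; _↔_; Inverse)
open import Function.Construct.Composition using (_↔-∘_)
open import Function.Construct.Identity using (↔-id)
open import Relation.Binary.Construct.Closure.ReflexiveTransitive using (Star; ε; _◅_; _◅◅_)
open import Relation.Binary.PropositionalEquality
  using (_≡_; _≢_; refl; sym; trans; cong; cong₂; subst; subst₂; module ≡-Reasoning)
open import Relation.Nullary.Decidable
  using (Dec; yes; no; does; map′; recompute; ¬?; _×-dec_; _⊎-dec_; _→-dec_; dec-true; dec-false; does-⇔)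
open import Relation.Nullary.Negation using (¬_; contradiction)
open import Relation.Nullary.Reflects using (Reflects; ofʸ; ofⁿ; invert; det)

open Digraph
open LocalInput

-- Inner product has small discrepancy

∑ : {A : Set} → List A → (A → ℤ) → ℤ
∑ []       f = 0ℤ
∑ (x ∷ xs) f = f x ℤ.+ ∑ xs f

module _ {A : Set} where

  ∑-cong : ∀ xs {f g : A → ℤ} → (∀ x → f x ≡ g x) → ∑ xs f ≡ ∑ xs g
  ∑-cong []       f≡g = refl
  ∑-cong (x ∷ xs) f≡g = cong₂ ℤ._+_ (f≡g x) (∑-cong xs f≡g)

  ∑-mono : ∀ xs {f g : A → ℤ} → (∀ x → f x ℤ.≤ g x) → ∑ xs f ℤ.≤ ∑ xs g
  ∑-mono []       f≤g = ℤ.≤-refl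
  ∑-mono (x ∷ xs) f≤g = ℤ.+-mono-≤ (f≤g x) (∑-mono xs f≤g)

  ∑-0 : ∀ (xs : List A) → ∑ xs (λ _ → 0ℤ) ≡ 0ℤ
  ∑-0 []       = refl
  ∑-0 (x ∷ xs) = trans (ℤ.+-identityˡ _) (∑-0 xs)

  ∑-+ : ∀ xs (f g : A → ℤ) → ∑ xs (λ x → f x ℤ.+ g x) ≡ ∑ xs f ℤ.+ ∑ xs g
  ∑-+ []       f g = refl
  ∑-+ (x ∷ xs) f g =
    trans (cong (ℤ._+_ (f x ℤ.+ g x)) (∑-+ xs f g)) (interchange (f x) (g x) (∑ xs f) (∑ xs g))
    where
    interchange : ∀ a b c d → a ℤ.+ b ℤ.+ (c ℤ.+ d) ≡ a ℤ.+ c ℤ.+ (b ℤ.+ d)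
    interchange = ℤ-Solver.solve-∀

  ∑-*ˡ : ∀ c xs (f : A → ℤ) → ∑ xs (λ x → c ℤ.* f x) ≡ c ℤ.* ∑ xs f
  ∑-*ˡ c []       f = sym (ℤ.*-zeroʳ c)
  ∑-*ˡ c (x ∷ xs) f = trans (cong (ℤ._+_ (c ℤ.* f x)) (∑-*ˡ c xs f)) (sym (ℤ.*-distribˡ-+ c (f x) _))

  ∑-const : ∀ c (xs : List A) → ∑ xs (λ _ → c) ≡ + List.length xs ℤ.* c
  ∑-const c []       = refl
  ∑-const c (x ∷ xs) = trans (cong (ℤ._+_ c) (∑-const c xs)) (sym (ℤ.suc-* (+ List.length xs) c))

  ∑-++ : ∀ xs ys (f : A → ℤ) → ∑ (xs ++ ys) f ≡ ∑ xs f ℤ.+ ∑ ys f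
  ∑-++ []       ys f = sym (ℤ.+-identityˡ _)
  ∑-++ (x ∷ xs) ys f = trans (cong (ℤ._+_ (f x)) (∑-++ xs ys f)) (sym (ℤ.+-assoc (f x) _ _))

∑-swap : ∀ {A B : Set} xs ys (f : A → B → ℤ) →
         ∑ xs (λ x → ∑ ys (f x)) ≡ ∑ ys (λ y → ∑ xs (λ x → f x y))
∑-swap []       ys f = sym (∑-0 ys)
∑-swap (x ∷ xs) ys f = trans (cong (ℤ._+_ (∑ ys (f x))) (∑-swap xs ys f)) (sym (∑-+ ys (f x) _))

∑-map : ∀ {A B : Set} (h : A → B) xs f → ∑ (map h xs) f ≡ ∑ xs (f ∘ h)
∑-map h []       f = refl
∑-map h (x ∷ xs) f = cong (ℤ._+_ (f (h x))) (∑-map h xs f)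

∑-allFin-suc : ∀ n (f : Fin (suc n) → ℤ) →
               ∑ (allFin (suc n)) f ≡ f zero ℤ.+ ∑ (allFin n) (f ∘ suc)
∑-allFin-suc n f = cong (ℤ._+_ (f zero))
  (trans (cong (λ xs → ∑ xs f) (sym (List.map-tabulate id suc))) (∑-map suc (allFin n) f))

length-allFin : ∀ n → List.length (allFin n) ≡ n
length-allFin n = List.length-tabulate {n = n} id

ind : Bool → ℤ
ind b = if b then 1ℤ else 0ℤ

-- The delta function sifts out one term. It splits a sum by the value of a transcript, and it
-- singles out one outcome in `disjoint-triple`.
∑-ind-≟ : ∀ {n} (i : Fin n) c → ∑ (allFin n) (λ k → ind (does (i Fin.≟ k)) ℤ.* c) ≡ c
∑-ind-≟ {suc n} zero c = trans
  (∑-allFin-suc n (λ k → ind (does (zero Fin.≟ k)) ℤ.* c))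
  (trans (cong₂ ℤ._+_ (ℤ.*-identityˡ c) (∑-0 (allFin n))) (ℤ.+-identityʳ c))
∑-ind-≟ {suc n} (suc i) c = trans
  (∑-allFin-suc n (λ k → ind (does (suc i Fin.≟ k)) ℤ.* c))
  (trans (ℤ.+-identityˡ _) (∑-ind-≟ i c))

∑-ind-lookup : ∀ {n} (S : Subset n) → ∑ (allFin n) (λ i → ind (lookup S i)) ≡ + ∣ S ∣
∑-ind-lookup []      = refl
∑-ind-lookup {suc n} (s ∷ S) = trans (∑-allFin-suc n (λ i → ind (lookup (s ∷ S) i)))
  (trans (cong (ℤ._+_ (ind s)) (∑-ind-lookup S)) (lem s))
  where
  lem : ∀ s → ind s ℤ.+ + ∣ S ∣ ≡ + ∣ s ∷ S ∣
  lem inside  = refl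
  lem outside = refl

-- The Boolean cube and the Walsh transform

cube : ∀ m → List (Vec Bool m)
cube zero    = [] ∷ []
cube (suc m) = map (false ∷_) (cube m) ++ map (true ∷_) (cube m)

∑-cube-suc : ∀ m (f : Vec Bool (suc m) → ℤ) →
             ∑ (cube (suc m)) f ≡ ∑ (cube m) (f ∘ (false ∷_)) ℤ.+ ∑ (cube m) (f ∘ (true ∷_))
∑-cube-suc m f = trans (∑-++ (map (false ∷_) (cube m)) _ f)
  (cong₂ ℤ._+_ (∑-map (false ∷_) (cube m) f) (∑-map (true ∷_) (cube m) f))

length-cube : ∀ m → List.length (cube m) ≡ 2 ^ m
length-cube zero    = refl
length-cube (suc m) = trans (List.length-++ (map (false ∷_) (cube m)))
  (cong₂ _+_ (trans (List.length-map _ (cube m)) (length-cube m))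
             (trans (trans (List.length-map _ (cube m)) (length-cube m)) (sym (ℕ.+-identityʳ _))))

∑-cube-const : ∀ m c → ∑ (cube m) (λ _ → c) ≡ + (2 ^ m) ℤ.* c
∑-cube-const m c = trans (∑-const c (cube m)) (cong (λ k → + k ℤ.* c) (length-cube m))

∃-cube? : ∀ {m} {P : Vec Bool m → Set} → (∀ x → Dec (P x)) → Dec (∃ P)
∃-cube? {zero}  P? = map′ ([] ,_) (λ { ([] , p) → p }) (P? [])
∃-cube? {suc m} P? = map′
  (λ { (inj₁ (x , p)) → (false ∷ x) , p ; (inj₂ (x , p)) → (true ∷ x) , p })
  (λ { ((false ∷ x) , p) → inj₁ (x , p) ; ((true ∷ x) , p) → inj₂ (x , p) })
  (∃-cube? (P? ∘ (false ∷_)) ⊎-dec ∃-cube? (P? ∘ (true ∷_)))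

infix 8 _∙_

_∙_ : ∀ {m} → Vec Bool m → Vec Bool m → Bool
[]      ∙ []      = false
(a ∷ x) ∙ (b ∷ y) = (a ∧ b) xor (x ∙ y)

sign : Bool → ℤ
sign b = if b then -1ℤ else 1ℤ

sign-not : ∀ b → sign (not b) ≡ ℤ.- sign b
sign-not false = refl
sign-not true  = refl

-- Not normalised, whence the factor `2 ^ m` in `parseval`.
walsh : ∀ {m} → (Vec Bool m → ℤ) → Vec Bool m → ℤ
walsh {m} g x = ∑ (cube m) (λ y → sign (x ∙ y) ℤ.* g y)

module _ {m} (g : Vec Bool (suc m) → ℤ) (x : Vec Bool m) where

  -- The butterfly step: splitting off the first coordinate yields the sum of two smaller transforms
  -- for `false` and their difference for `true`.
  walsh-false : walsh g (false ∷ x) ≡ walsh (g ∘ (false ∷_)) x ℤ.+ walsh (g ∘ (true ∷_)) x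
  walsh-false = ∑-cube-suc m (λ y → sign ((false ∷ x) ∙ y) ℤ.* g y)

  walsh-true : walsh g (true ∷ x) ≡ walsh (g ∘ (false ∷_)) x ℤ.- walsh (g ∘ (true ∷_)) x
  walsh-true = trans (∑-cube-suc m (λ y → sign ((true ∷ x) ∙ y) ℤ.* g y))
    (cong (ℤ._+_ (walsh (g ∘ (false ∷_)) x)) (begin
      ∑ (cube m) (λ y → sign (not (x ∙ y)) ℤ.* g (true ∷ y))   ≡⟨ ∑-cong (cube m) negate ⟩
      ∑ (cube m) (λ y → -1ℤ ℤ.* (sign (x ∙ y) ℤ.* g (true ∷ y))) ≡⟨ ∑-*ˡ -1ℤ (cube m) _ ⟩
      -1ℤ ℤ.* walsh (g ∘ (true ∷_)) x                          ≡⟨ ℤ.-1*i≡-i _ ⟩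
      ℤ.- walsh (g ∘ (true ∷_)) x                              ∎))
    where
    open ≡-Reasoning
    negate : ∀ y → sign (not (x ∙ y)) ℤ.* g (true ∷ y) ≡ -1ℤ ℤ.* (sign (x ∙ y) ℤ.* g (true ∷ y))
    negate y = trans (cong (ℤ._* g (true ∷ y)) (trans (sign-not (x ∙ y)) (sym (ℤ.-1*i≡-i _))))
                     (ℤ.*-assoc -1ℤ (sign (x ∙ y)) (g (true ∷ y)))

-- By induction on `m`: the butterfly turns the two halves a and b into a + b and a - b, whose
-- squares add up to 2 a² + 2 b².
parseval : ∀ {m} (g : Vec Bool m → ℤ) →
           ∑ (cube m) (λ x → walsh g x ℤ.* walsh g x) ≡ + (2 ^ m) ℤ.* ∑ (cube m) (λ y → g y ℤ.* g y)
parseval {zero}  g = lem (g [])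
  where
  lem : ∀ a → (1ℤ ℤ.* a ℤ.+ 0ℤ) ℤ.* (1ℤ ℤ.* a ℤ.+ 0ℤ) ℤ.+ 0ℤ ≡ + 1 ℤ.* (a ℤ.* a ℤ.+ 0ℤ)
  lem = ℤ-Solver.solve-∀
parseval {suc m} g = begin
  ∑ (cube (suc m)) (λ x → walsh g x ℤ.* walsh g x)
    ≡⟨ ∑-cube-suc m (λ x → walsh g x ℤ.* walsh g x) ⟩
  ∑ (cube m) (λ x → walsh g (false ∷ x) ℤ.* walsh g (false ∷ x)) ℤ.+
  ∑ (cube m) (λ x → walsh g (true ∷ x) ℤ.* walsh g (true ∷ x))
    ≡⟨ ∑-+ (cube m) _ _ ⟨
  ∑ (cube m) (λ x → walsh g (false ∷ x) ℤ.* walsh g (false ∷ x) ℤ.+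
                    walsh g (true ∷ x) ℤ.* walsh g (true ∷ x))
    ≡⟨ ∑-cong (cube m) (λ x → trans
         (cong₂ (λ u v → u ℤ.* u ℤ.+ v ℤ.* v) (walsh-false g x) (walsh-true g x))
         (parallelogram (walsh g₀ x) (walsh g₁ x))) ⟩
  ∑ (cube m) (λ x → + 2 ℤ.* (walsh g₀ x ℤ.* walsh g₀ x) ℤ.+ + 2 ℤ.* (walsh g₁ x ℤ.* walsh g₁ x))
    ≡⟨ ∑-+ (cube m) _ _ ⟩
  ∑ (cube m) (λ x → + 2 ℤ.* (walsh g₀ x ℤ.* walsh g₀ x)) ℤ.+
  ∑ (cube m) (λ x → + 2 ℤ.* (walsh g₁ x ℤ.* walsh g₁ x))
    ≡⟨ cong₂ ℤ._+_ (half g₀) (half g₁) ⟩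
  + 2 ℤ.* (+ (2 ^ m) ℤ.* ∑ (cube m) (λ y → g₀ y ℤ.* g₀ y)) ℤ.+
  + 2 ℤ.* (+ (2 ^ m) ℤ.* ∑ (cube m) (λ y → g₁ y ℤ.* g₁ y))
    ≡⟨ collect (+ (2 ^ m)) _ _ ⟩
  (+ 2 ℤ.* + (2 ^ m)) ℤ.*
  (∑ (cube m) (λ y → g₀ y ℤ.* g₀ y) ℤ.+ ∑ (cube m) (λ y → g₁ y ℤ.* g₁ y))
    ≡⟨ cong₂ ℤ._*_ (ℤ.pos-* 2 (2 ^ m)) (∑-cube-suc m (λ y → g y ℤ.* g y)) ⟨
  + (2 ^ suc m) ℤ.* ∑ (cube (suc m)) (λ y → g y ℤ.* g y) ∎
  where
  open ≡-Reasoning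
  g₀ = g ∘ (false ∷_)
  g₁ = g ∘ (true ∷_)
  parallelogram : ∀ a b → (a ℤ.+ b) ℤ.* (a ℤ.+ b) ℤ.+ (a ℤ.- b) ℤ.* (a ℤ.- b) ≡
                          + 2 ℤ.* (a ℤ.* a) ℤ.+ + 2 ℤ.* (b ℤ.* b)
  parallelogram = ℤ-Solver.solve-∀
  collect : ∀ p a b → + 2 ℤ.* (p ℤ.* a) ℤ.+ + 2 ℤ.* (p ℤ.* b) ≡ (+ 2 ℤ.* p) ℤ.* (a ℤ.+ b)
  collect = ℤ-Solver.solve-∀
  half : ∀ (h : Vec Bool m → ℤ) → ∑ (cube m) (λ x → + 2 ℤ.* (walsh h x ℤ.* walsh h x)) ≡
         + 2 ℤ.* (+ (2 ^ m) ℤ.* ∑ (cube m) (λ y → h y ℤ.* h y))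
  half h = trans (∑-*ˡ (+ 2) (cube m) _) (cong (ℤ._*_ (+ 2)) (parseval h))

square-≥0 : ∀ i → 0ℤ ℤ.≤ i ℤ.* i
square-≥0 (+ n)      = subst (0ℤ ℤ.≤_) (ℤ.pos-* n n) (ℤ.+≤+ z≤n)
square-≥0 (ℤ.-[1+ n ]) = ℤ.+≤+ z≤n

-- AM–GM.  It stands in for Cauchy–Schwarz, with Q playing the role of the
-- typical size of v.
2Qsav≤v²+Q² : ∀ Q s a v → + 2 ℤ.* Q ℤ.* (sign s ℤ.* ind a ℤ.* v) ℤ.≤ v ℤ.* v ℤ.+ Q ℤ.* Q
2Qsav≤v²+Q² Q s a v = ℤ.0≤i-j⇒j≤i (lem s a)
  where
  zero-case : ∀ s Q v → v ℤ.* v ℤ.+ Q ℤ.* Q ℤ.- + 2 ℤ.* Q ℤ.* (s ℤ.* 0ℤ ℤ.* v) ≡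
              v ℤ.* v ℤ.+ Q ℤ.* Q
  zero-case = ℤ-Solver.solve-∀
  plus-case : ∀ Q v → v ℤ.* v ℤ.+ Q ℤ.* Q ℤ.- + 2 ℤ.* Q ℤ.* (1ℤ ℤ.* 1ℤ ℤ.* v) ≡ (v ℤ.- Q) ℤ.* (v ℤ.- Q)
  plus-case = ℤ-Solver.solve-∀
  minus-case : ∀ Q v → v ℤ.* v ℤ.+ Q ℤ.* Q ℤ.- + 2 ℤ.* Q ℤ.* (-1ℤ ℤ.* 1ℤ ℤ.* v) ≡ (v ℤ.+ Q) ℤ.* (v ℤ.+ Q)
  minus-case = ℤ-Solver.solve-∀
  lem : ∀ s a → 0ℤ ℤ.≤ v ℤ.* v ℤ.+ Q ℤ.* Q ℤ.- + 2 ℤ.* Q ℤ.* (sign s ℤ.* ind a ℤ.* v)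
  lem s     false = subst (0ℤ ℤ.≤_) (sym (zero-case (sign s) Q v)) (ℤ.+-mono-≤ (square-≥0 v) (square-≥0 Q))
  lem false true  = subst (0ℤ ℤ.≤_) (sym (plus-case Q v)) (square-≥0 (v ℤ.- Q))
  lem true  true  = subst (0ℤ ℤ.≤_) (sym (minus-case Q v)) (square-≥0 (v ℤ.+ Q))

-- What is left of a communication protocol for the discrepancy bound: its
-- transcript, whose fibres are rectangles, and its output.
record Protocol (m K : ℕ) : Set where
  field
    transcript  : Vec Bool m → Vec Bool m → Fin K
    output      : Vec Bool m → Vec Bool m → Bool
    -- One corner suffices: exchanging the two pairs gives the other one.
    rectangular : ∀ {x y x′ y′} → transcript x y ≡ transcript x′ y′ → transcript x y′ ≡ transcript x y
    determined  : ∀ {x y x′ y′} → transcript x y ≡ transcript x′ y′ → output x y ≡ output x′ y′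

-- `Q` is the square root of `2 ^ m`; it is a natural number in the application, where `m` is even.
module _ {m K} (Π : Protocol m K) {Q : ℕ} (Q² : Q * Q ≡ 2 ^ m) where
  open Protocol Π

  private
    4^m : ℤ
    4^m = + (2 ^ m) ℤ.* + (2 ^ m)

    agreement : Vec Bool m → Vec Bool m → ℤ
    agreement x y = sign (output x y) ℤ.* sign (x ∙ y)

    piece : Fin K → Vec Bool m → Vec Bool m → ℤ
    piece k x y = ind (does (transcript x y Fin.≟ k)) ℤ.* agreement x y

  -- Lindsey's lemma. The fibre of `k` is a rectangle on which the output is constant, so each row
  -- sum is, up to sign, either 0 or a Walsh coefficient of the indicator of the columns. After
  -- AM-GM, Parseval bounds the squared coefficients by 4ᵐ in total, and the terms Q² = 2ᵐ
  -- contribute another 4ᵐ.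
  rectangle-discrepancy : ∀ k → + 2 ℤ.* + Q ℤ.* ∑ (cube m) (λ x → ∑ (cube m) (piece k x)) ℤ.≤ + 2 ℤ.* 4^m
  rectangle-discrepancy k with ∃-cube? (λ x → ∃-cube? (λ y → transcript x y Fin.≟ k))
  ... | no empty = subst (ℤ._≤ + 2 ℤ.* 4^m) (sym vanishes) (subst (0ℤ ℤ.≤_) (double 4^m) (ℤ.+-mono-≤ 0≤4^m 0≤4^m))
    where
    0≤4^m : 0ℤ ℤ.≤ 4^m
    0≤4^m = square-≥0 (+ (2 ^ m))
    double : ∀ i → i ℤ.+ i ≡ + 2 ℤ.* i
    double = ℤ-Solver.solve-∀
    piece≡0 : ∀ x y → piece k x y ≡ 0ℤ
    piece≡0 x y rewrite dec-false (transcript x y Fin.≟ k) (λ eq → empty (x , y , eq)) = refl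
    vanishes : + 2 ℤ.* + Q ℤ.* ∑ (cube m) (λ x → ∑ (cube m) (piece k x)) ≡ 0ℤ
    vanishes = trans (cong (ℤ._*_ (+ 2 ℤ.* + Q))
      (trans (∑-cong (cube m) (λ x → trans (∑-cong (cube m) (piece≡0 x)) (∑-0 (cube m)))) (∑-0 (cube m))))
      (ℤ.*-zeroʳ (+ 2 ℤ.* + Q))
  ... | yes (x₀ , y₀ , eq₀) = begin
    + 2 ℤ.* + Q ℤ.* ∑ (cube m) (λ x → ∑ (cube m) (piece k x))
      ≡⟨ cong (ℤ._*_ (+ 2 ℤ.* + Q)) (∑-cong (cube m) row) ⟩
    + 2 ℤ.* + Q ℤ.* ∑ (cube m) (λ x → sign σ ℤ.* ind (A x) ℤ.* walsh (ind ∘ B) x)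
      ≡⟨ ∑-*ˡ (+ 2 ℤ.* + Q) (cube m) _ ⟨
    ∑ (cube m) (λ x → + 2 ℤ.* + Q ℤ.* (sign σ ℤ.* ind (A x) ℤ.* walsh (ind ∘ B) x))
      ≤⟨ ∑-mono (cube m) (λ x → 2Qsav≤v²+Q² (+ Q) σ (A x) (walsh (ind ∘ B) x)) ⟩
    ∑ (cube m) (λ x → walsh (ind ∘ B) x ℤ.* walsh (ind ∘ B) x ℤ.+ + Q ℤ.* + Q)
      ≡⟨ ∑-+ (cube m) _ _ ⟩
    ∑ (cube m) (λ x → walsh (ind ∘ B) x ℤ.* walsh (ind ∘ B) x) ℤ.+ ∑ (cube m) (λ _ → + Q ℤ.* + Q)
      ≡⟨ cong₂ ℤ._+_ (parseval (ind ∘ B)) (∑-cube-const m _) ⟩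
    + (2 ^ m) ℤ.* ∑ (cube m) (λ y → ind (B y) ℤ.* ind (B y)) ℤ.+ + (2 ^ m) ℤ.* (+ Q ℤ.* + Q)
      ≤⟨ ℤ.+-monoˡ-≤ _ (ℤ.*-monoˡ-≤-nonNeg (+ (2 ^ m)) size-B) ⟩
    4^m ℤ.+ + (2 ^ m) ℤ.* (+ Q ℤ.* + Q)
      ≡⟨ cong (λ i → 4^m ℤ.+ + (2 ^ m) ℤ.* i) (trans (sym (ℤ.pos-* Q Q)) (cong +_ Q²)) ⟩
    4^m ℤ.+ 4^m
      ≡⟨ double 4^m ⟩
    + 2 ℤ.* 4^m ∎
    where
    open ℤ.≤-Reasoning
    -- Membership in the fibre along the column and the row of the base point. By `rectangular` the
    -- fibre is the product of the two, which is `split`.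
    A B : Vec Bool m → Bool
    A x = does (transcript x y₀ Fin.≟ k)
    B y = does (transcript x₀ y Fin.≟ k)
    σ = output x₀ y₀
    double : ∀ i → i ℤ.+ i ≡ + 2 ℤ.* i
    double = ℤ-Solver.solve-∀
    arrange-false : ∀ s v w → 0ℤ ℤ.* w ≡ s ℤ.* 0ℤ ℤ.* v
    arrange-false = ℤ-Solver.solve-∀
    arrange-true : ∀ s h → 1ℤ ℤ.* (s ℤ.* h) ≡ s ℤ.* 1ℤ ℤ.* (h ℤ.* 1ℤ)
    arrange-true = ℤ-Solver.solve-∀
    arrange-half : ∀ s h w → 0ℤ ℤ.* w ≡ s ℤ.* 1ℤ ℤ.* (h ℤ.* 0ℤ)
    arrange-half = ℤ-Solver.solve-∀
    split : ∀ x y → piece k x y ≡ sign σ ℤ.* ind (A x) ℤ.* (sign (x ∙ y) ℤ.* ind (B y))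
    split x y with transcript x y₀ Fin.≟ k | transcript x₀ y Fin.≟ k
    ... | yes p | yes q
      rewrite dec-true (transcript x y Fin.≟ k) (trans (rectangular (trans p (sym q))) p)
            | determined {x} {y} {x₀} {y₀} (trans (trans (rectangular (trans p (sym q))) p) (sym eq₀))
      = arrange-true (sign σ) (sign (x ∙ y))
    ... | no ¬p | d
      rewrite dec-false (transcript x y Fin.≟ k) (λ r → ¬p (trans (rectangular (trans r (sym eq₀))) r))
      = arrange-false (sign σ) _ (agreement x y)
    ... | yes p | no ¬q
      rewrite dec-false (transcript x y Fin.≟ k) (λ r → ¬q (trans (rectangular (trans eq₀ (sym r))) eq₀))
      = arrange-half (sign σ) (sign (x ∙ y)) (agreement x y)
    row : ∀ x → ∑ (cube m) (piece k x) ≡ sign σ ℤ.* ind (A x) ℤ.* walsh (ind ∘ B) x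
    row x = trans (∑-cong (cube m) (split x)) (∑-*ˡ (sign σ ℤ.* ind (A x)) (cube m) _)
    ind²≤1 : ∀ b → ind b ℤ.* ind b ℤ.≤ 1ℤ
    ind²≤1 false = ℤ.+≤+ z≤n
    ind²≤1 true  = ℤ.≤-refl
    size-B : ∑ (cube m) (λ y → ind (B y) ℤ.* ind (B y)) ℤ.≤ + (2 ^ m)
    size-B = ℤ.≤-trans (∑-mono (cube m) (λ y → ind²≤1 (B y)))
      (ℤ.≤-reflexive (trans (∑-cube-const m 1ℤ) (ℤ.*-identityʳ _)))

  -- Each pair of inputs lies in exactly one fibre, so the correlation of the output with the inner
  -- product is a sum of `K` rectangle terms.
  discrepancy : + 2 ℤ.* + Q ℤ.* ∑ (cube m) (λ x → ∑ (cube m) (agreement x)) ℤ.≤ + K ℤ.* (+ 2 ℤ.* 4^m)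
  discrepancy = begin
    + 2 ℤ.* + Q ℤ.* ∑ (cube m) (λ x → ∑ (cube m) (agreement x))
      ≡⟨ cong (ℤ._*_ (+ 2 ℤ.* + Q)) partition ⟩
    + 2 ℤ.* + Q ℤ.* ∑ (allFin K) (λ k → ∑ (cube m) (λ x → ∑ (cube m) (piece k x)))
      ≡⟨ ∑-*ˡ (+ 2 ℤ.* + Q) (allFin K) _ ⟨
    ∑ (allFin K) (λ k → + 2 ℤ.* + Q ℤ.* ∑ (cube m) (λ x → ∑ (cube m) (piece k x)))
      ≤⟨ ∑-mono (allFin K) rectangle-discrepancy ⟩
    ∑ (allFin K) (λ _ → + 2 ℤ.* 4^m)
      ≡⟨ ∑-const _ (allFin K) ⟩
    + List.length (allFin K) ℤ.* (+ 2 ℤ.* 4^m)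
      ≡⟨ cong (λ l → + l ℤ.* (+ 2 ℤ.* 4^m)) (length-allFin K) ⟩
    + K ℤ.* (+ 2 ℤ.* 4^m) ∎
    where
    open ℤ.≤-Reasoning
    partition : ∑ (cube m) (λ x → ∑ (cube m) (agreement x)) ≡
                ∑ (allFin K) (λ k → ∑ (cube m) (λ x → ∑ (cube m) (piece k x)))
    partition = trans
      (∑-cong (cube m) λ x → trans
        (∑-cong (cube m) λ y → sym (∑-ind-≟ (transcript x y) (agreement x y)))
        (∑-swap (cube m) (allFin K) (λ y k → piece k x y)))
      (∑-swap (cube m) (allFin K) (λ x k → ∑ (cube m) (piece k x)))

  -- `c` marks pairs on which the output is right. There the agreement is 1, and elsewhere it is at
  -- least -1, so twice the indicator of `c` is at most 1 plus the agreement.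
  success-bound : (c : Vec Bool m → Vec Bool m → Bool) →
    (∀ x y → c x y ≡ true → output x y ≡ x ∙ y) →
    + 2 ℤ.* + Q ℤ.* ∑ (cube m) (λ x → ∑ (cube m) (ind ∘ c x)) ℤ.≤ (+ Q ℤ.+ + K) ℤ.* 4^m
  success-bound c correct = ℤ.*-cancelˡ-≤-pos _ _ (+ 2) (begin
    + 2 ℤ.* (+ 2 ℤ.* + Q ℤ.* ∑ (cube m) (λ x → ∑ (cube m) (ind ∘ c x)))
      ≡⟨ rotate (+ Q) _ ⟩
    + 2 ℤ.* + Q ℤ.* (+ 2 ℤ.* ∑ (cube m) (λ x → ∑ (cube m) (ind ∘ c x)))
      ≡⟨ cong (ℤ._*_ (+ 2 ℤ.* + Q)) (trans (∑-cong (cube m) (λ x → ∑-*ˡ (+ 2) (cube m) _)) (∑-*ˡ (+ 2) (cube m) _)) ⟨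
    + 2 ℤ.* + Q ℤ.* ∑ (cube m) (λ x → ∑ (cube m) (λ y → + 2 ℤ.* ind (c x y)))
      ≤⟨ ℤ.*-monoˡ-≤-nonNeg (+ 2 ℤ.* + Q) {{nonNeg}} (∑-mono (cube m) (λ x → ∑-mono (cube m) (pointwise x))) ⟩
    + 2 ℤ.* + Q ℤ.* ∑ (cube m) (λ x → ∑ (cube m) (λ y → 1ℤ ℤ.+ agreement x y))
      ≡⟨ cong (ℤ._*_ (+ 2 ℤ.* + Q)) (trans
           (∑-cong (cube m) (λ x → trans (∑-+ (cube m) _ _)
             (cong₂ ℤ._+_ (trans (∑-cube-const m 1ℤ) (ℤ.*-identityʳ (+ (2 ^ m)))) refl)))
           (trans (∑-+ (cube m) (λ _ → + (2 ^ m)) (λ x → ∑ (cube m) (agreement x)))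
             (cong₂ ℤ._+_ (∑-cube-const m (+ (2 ^ m))) refl))) ⟩
    + 2 ℤ.* + Q ℤ.* (4^m ℤ.+ ∑ (cube m) (λ x → ∑ (cube m) (agreement x)))
      ≡⟨ ℤ.*-distribˡ-+ (+ 2 ℤ.* + Q) 4^m _ ⟩
    + 2 ℤ.* + Q ℤ.* 4^m ℤ.+ + 2 ℤ.* + Q ℤ.* ∑ (cube m) (λ x → ∑ (cube m) (agreement x))
      ≤⟨ ℤ.+-monoʳ-≤ (+ 2 ℤ.* + Q ℤ.* 4^m) discrepancy ⟩
    + 2 ℤ.* + Q ℤ.* 4^m ℤ.+ + K ℤ.* (+ 2 ℤ.* 4^m)
      ≡⟨ collect (+ Q) (+ K) 4^m ⟩
    + 2 ℤ.* ((+ Q ℤ.+ + K) ℤ.* 4^m) ∎)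
    where
    open ℤ.≤-Reasoning
    nonNeg : ℤ.NonNegative (+ 2 ℤ.* + Q)
    nonNeg = subst ℤ.NonNegative (ℤ.pos-* 2 Q) _
    rotate : ∀ q s → + 2 ℤ.* (+ 2 ℤ.* q ℤ.* s) ≡ + 2 ℤ.* q ℤ.* (+ 2 ℤ.* s)
    rotate = ℤ-Solver.solve-∀
    collect : ∀ q k p → + 2 ℤ.* q ℤ.* p ℤ.+ k ℤ.* (+ 2 ℤ.* p) ≡ + 2 ℤ.* ((q ℤ.+ k) ℤ.* p)
    collect = ℤ-Solver.solve-∀
    sign² : ∀ b → + 2 ≡ 1ℤ ℤ.+ sign b ℤ.* sign b
    sign² false = refl
    sign² true  = refl
    0≤1+sign : ∀ a b → 0ℤ ℤ.≤ 1ℤ ℤ.+ sign a ℤ.* sign b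
    0≤1+sign false false = ℤ.+≤+ z≤n
    0≤1+sign false true  = ℤ.+≤+ z≤n
    0≤1+sign true  false = ℤ.+≤+ z≤n
    0≤1+sign true  true  = ℤ.+≤+ z≤n
    pointwise : ∀ x y → + 2 ℤ.* ind (c x y) ℤ.≤ 1ℤ ℤ.+ agreement x y
    pointwise x y with c x y in eq
    ... | false = 0≤1+sign (output x y) (x ∙ y)
    ... | true rewrite correct x y eq = ℤ.≤-reflexive (sign² (x ∙ y))

-- Averaging the success bound over the private coins ω.
inner-product-bound : ∀ {m K Q N} → Q * Q ≡ 2 ^ m → .{{_ : NonZero N}} →
  (Π : Fin N → Protocol m K) (S : Vec Bool m → Vec Bool m → Subset N) →
  (∀ x y → 2 * N ≤ 3 * ∣ S x y ∣) →
  (∀ ω x y → lookup (S x y) ω ≡ true → Protocol.output (Π ω) x y ≡ x ∙ y) →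
  Q ≤ 3 * K
inner-product-bound {m} {K} {Q} {N} Q² Π S large correct =
  -- Cancelling `weight` in `total` leaves 4 Q ≤ 3 (Q + K), from which 3 Q is subtracted.
  ℕ.+-cancelˡ-≤ (3 * Q) Q (3 * K) (subst₂ _≤_ (four Q) (ℕ.*-distribˡ-+ 3 Q K)
    (ℤ.drop‿+≤+ (subst₂ ℤ._≤_ (sym (ℤ.pos-* 4 Q)) (cong (ℤ._*_ (+ 3)) (sym (ℤ.pos-+ Q K)) ⟫ sym (ℤ.pos-* 3 (Q + K)))
      (ℤ.*-cancelʳ-≤-pos _ _ weight {{positive}} total))))
  where
  infixr 1 _⟫_
  _⟫_ : ∀ {i j k : ℤ} → i ≡ j → j ≡ k → i ≡ k
  _⟫_ = trans
  four : ∀ q → 4 * q ≡ 3 * q + q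
  four = ℕ-Solver.solve-∀
  weight : ℤ
  weight = + N ℤ.* (+ (2 ^ m) ℤ.* + (2 ^ m))
  positive : ℤ.Positive weight
  positive = subst ℤ.Positive
    (ℤ.pos-* N (2 ^ m * 2 ^ m) ⟫ cong (ℤ._*_ (+ N)) (ℤ.pos-* (2 ^ m) (2 ^ m)))
    (ℤ.positive {+ (N * (2 ^ m * 2 ^ m))} (ℤ.+<+ (ℕ.*-mono-< {0} {N} {0} (>-nonZero⁻¹ N)
      (ℕ.*-mono-< {0} {2 ^ m} {0} (ℕ.m^n>0 2 m) (ℕ.m^n>0 2 m)))))
  successes : Fin N → ℤ
  successes ω = ∑ (cube m) (λ x → ∑ (cube m) (λ y → ind (lookup (S x y) ω)))
  sizes : ℤ
  sizes = ∑ (cube m) (λ x → ∑ (cube m) (λ y → + ∣ S x y ∣))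
  double-count : ∑ (allFin N) successes ≡ sizes
  double-count = ∑-swap (allFin N) (cube m) _ ⟫ ∑-cong (cube m) (λ x →
    ∑-swap (allFin N) (cube m) _ ⟫ ∑-cong (cube m) (λ y → ∑-ind-lookup (S x y)))
  large-sizes : + 2 ℤ.* weight ℤ.≤ + 3 ℤ.* sizes
  large-sizes = subst₂ ℤ._≤_
    (∑-cong (cube m) (λ x → ∑-cube-const m _) ⟫ ∑-cube-const m _ ⟫ rearrange (+ (2 ^ m)) (+ N))
    (∑-cong (cube m) (λ x → ∑-*ˡ (+ 3) (cube m) (λ y → + ∣ S x y ∣)) ⟫ ∑-*ˡ (+ 3) (cube m) _)
    (∑-mono (cube m) (λ x → ∑-mono (cube m) (λ y →
      subst₂ ℤ._≤_ (ℤ.pos-* 2 N) (ℤ.pos-* 3 ∣ S x y ∣) (ℤ.+≤+ (large x y)))))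
    where
    rearrange : ∀ p n → p ℤ.* (p ℤ.* (+ 2 ℤ.* n)) ≡ + 2 ℤ.* (n ℤ.* (p ℤ.* p))
    rearrange = ℤ-Solver.solve-∀
  open ℤ.≤-Reasoning
  total : + 4 ℤ.* + Q ℤ.* weight ℤ.≤ + 3 ℤ.* (+ Q ℤ.+ + K) ℤ.* weight
  total = begin
    + 4 ℤ.* + Q ℤ.* weight                                   ≡⟨ regroup (+ Q) weight ⟩
    + 2 ℤ.* + Q ℤ.* (+ 2 ℤ.* weight)
      ≤⟨ ℤ.*-monoˡ-≤-nonNeg (+ 2 ℤ.* + Q) {{subst ℤ.NonNegative (ℤ.pos-* 2 Q) _}} large-sizes ⟩
    + 2 ℤ.* + Q ℤ.* (+ 3 ℤ.* sizes)                          ≡⟨ exchange (+ 2 ℤ.* + Q) sizes ⟩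
    + 3 ℤ.* (+ 2 ℤ.* + Q ℤ.* sizes)
      ≡⟨ cong (λ s → + 3 ℤ.* (+ 2 ℤ.* + Q ℤ.* s)) double-count ⟨
    + 3 ℤ.* (+ 2 ℤ.* + Q ℤ.* ∑ (allFin N) successes)
      ≡⟨ cong (ℤ._*_ (+ 3)) (∑-*ˡ (+ 2 ℤ.* + Q) (allFin N) successes) ⟨
    + 3 ℤ.* ∑ (allFin N) (λ ω → + 2 ℤ.* + Q ℤ.* successes ω)
      ≤⟨ ℤ.*-monoˡ-≤-nonNeg (+ 3) (∑-mono (allFin N) (λ ω →
           success-bound (Π ω) {Q} Q² (λ x y → lookup (S x y) ω) (correct ω))) ⟩
    + 3 ℤ.* ∑ (allFin N) (λ _ → (+ Q ℤ.+ + K) ℤ.* (+ (2 ^ m) ℤ.* + (2 ^ m)))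
      ≡⟨ cong (ℤ._*_ (+ 3)) (∑-const _ (allFin N) ⟫ cong (λ l → + l ℤ.* _) (length-allFin N)) ⟩
    + 3 ℤ.* (+ N ℤ.* ((+ Q ℤ.+ + K) ℤ.* (+ (2 ^ m) ℤ.* + (2 ^ m))))
      ≡⟨ reassoc (+ Q ℤ.+ + K) (+ N) _ ⟩
    + 3 ℤ.* (+ Q ℤ.+ + K) ℤ.* weight ∎
    where
    regroup : ∀ q w → + 4 ℤ.* q ℤ.* w ≡ + 2 ℤ.* q ℤ.* (+ 2 ℤ.* w)
    regroup = ℤ-Solver.solve-∀
    exchange : ∀ a s → a ℤ.* (+ 3 ℤ.* s) ≡ + 3 ℤ.* (a ℤ.* s)
    exchange = ℤ-Solver.solve-∀
    reassoc : ∀ a n p → + 3 ℤ.* (n ℤ.* (a ℤ.* p)) ≡ + 3 ℤ.* a ℤ.* (n ℤ.* p)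
    reassoc = ℤ-Solver.solve-∀

-- Distances and indistinguishability

least : {P : ℕ → Set} → (∀ n → Dec (P n)) → ∀ n → P n → Σ[ d ∈ ℕ ] P d × d ≤ n × (∀ k → P k → d ≤ k)
least {P} P? = <-rec _ step
  where
  step : ∀ n → (∀ {m} → m < n → P m → Σ[ d ∈ ℕ ] P d × d ≤ m × (∀ k → P k → d ≤ k)) →
         P n → Σ[ d ∈ ℕ ] P d × d ≤ n × (∀ k → P k → d ≤ k)
  step n rec Pn with ℕ.anyUpTo? P? n
  ... | yes (m , m<n , Pm) = let d , Pd , d≤m , min = rec m<n Pm in d , Pd , ℕ.≤-trans d≤m (ℕ.<⇒≤ m<n) , min
  ... | no none = n , Pn , ℕ.≤-refl , λ k Pk → ℕ.≮⇒≥ (λ k<n → none (k , k<n , Pk))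

module _ {V : Set} {E : V → V → Set} where

  length-◅◅ : ∀ {u v w} (p : Star E u v) (q : Star E v w) → length (p ◅◅ q) ≡ length p + length q
  length-◅◅ ε       q = refl
  length-◅◅ (_ ◅ p) q = cong suc (length-◅◅ p q)

  length-lipschitz : (φ : V → ℕ) → (∀ {u v} → E u v → φ u ≤ suc (φ v)) →
                     ∀ {u v} (p : Star E u v) → φ u ≤ length p + φ v
  length-lipschitz φ lip ε       = ℕ.≤-refl
  length-lipschitz φ lip (e ◅ p) = ℕ.≤-trans (lip e) (s≤s (length-lipschitz φ lip p))

  Star-invariant : (P : V → Set) → (∀ {u v} → E u v → P u → P v) → ∀ {u v} → Star E u v → P u → P v
  Star-invariant P closed ε       Pu = Pu
  Star-invariant P closed (e ◅ p) Pu = Star-invariant P closed p (closed e Pu)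

module _ {n} {E : Fin n → Fin n → Set} (E? : ∀ u v → Dec (E u v)) where

  private
    Walk : ℕ → Fin n → Fin n → Set
    Walk zero    u v = u ≡ v
    Walk (suc k) u v = ∃[ w ] E u w × Walk k w v

    walk? : ∀ k u v → Dec (Walk k u v)
    walk? zero    u v = u Fin.≟ v
    walk? (suc k) u v = Fin.any? (λ w → E? u w ×-dec walk? k w v)

    fromStar : ∀ {u v} (p : Star E u v) → Walk (length p) u v
    fromStar ε       = refl
    fromStar (e ◅ p) = _ , e , fromStar p

    toStar : ∀ k {u v} → Walk k u v → Σ[ p ∈ Star E u v ] length p ≡ k
    toStar zero    refl        = ε , refl
    toStar (suc k) (_ , e , w) = let p , len = toStar k w in e ◅ p , cong suc len

  -- The existence of a walk of given length is decidable on a finite vertex set, so a minimal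
  -- length can be searched for below that of `p`.
  shortest : ∀ {u v} (p : Star E u v) → ∃[ d ] (IsDistance E u v d × d ≤ length p)
  shortest {u} {v} p =
    let d , w , d≤ , min = least (λ k → walk? k u v) (length p) (fromStar p)
    in  d , (toStar d w , λ q → min (length q) (fromStar q)) , d≤

module _ {n} (G : Digraph n) where

  Link-sym : ∀ {u v} → Link G u v → Link G v u
  Link-sym {u} {v} = subst T (Bool.∨-comm (edge G u v) (edge G v u))

  Edge⇒Link : ∀ {u v} → Edge G u v → Link G u v
  Edge⇒Link {u} {v} with edge G u v
  ... | true = id

  Link⇒Edge⊎Edge : ∀ {u v} → Link G u v → Edge G u v ⊎ Edge G v u
  Link⇒Edge⊎Edge {u} {v} l with edge G u v
  ... | true  = inj₁ _
  ... | false = inj₂ l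

  Within : Fin n → ℕ → Fin n → Set
  Within u d v = Σ[ p ∈ Star (Link G) u v ] length p ≤ d

  within-refl : ∀ {u d} → Within u d u
  within-refl = ε , z≤n

  within-link : ∀ {u v} → Link G u v → Within u 1 v
  within-link l = l ◅ ε , ℕ.≤-refl

  within-trans : ∀ {u v w d e} → Within u d v → Within v e w → Within u (d + e) w
  within-trans (p , p≤d) (q , q≤e) =
    p ◅◅ q , subst (_≤ _) (sym (length-◅◅ p q)) (ℕ.+-mono-≤ p≤d q≤e)

  within-mono : ∀ {u v d e} → d ≤ e → Within u d v → Within u e v
  within-mono d≤e (p , p≤d) = p , ℕ.≤-trans p≤d d≤e

  within-sym : ∀ {u v d} → Within u d v → Within v d u
  within-sym (p , p≤d) = let q , q≡ = reversed p in q , subst (_≤ _) (sym q≡) p≤d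
    where
    reversed : ∀ {u v} (p : Star (Link G) u v) → Σ[ q ∈ Star (Link G) v u ] length q ≡ length p
    reversed ε       = ε , refl
    reversed (l ◅ p) = let q , q≡ = reversed p in
      q ◅◅ (Link-sym l ◅ ε) ,
      trans (length-◅◅ q _) (trans (ℕ.+-comm _ 1) (cong suc q≡))

  -- The line realises the diameter, since φ bounds distances from below; all
  -- other vertices hang off its middle.
  line-diameter : ∀ {D mid e} (φ : Fin n → ℕ) → (∀ {u v} → Link G u v → φ u ≤ suc (φ v)) →
    (line : ∀ k → .(k ≤ D) → Fin n) → (∀ k .k≤D → φ (line k k≤D) ≡ k) →
    (∀ k .k<D → Link G (line k (ℕ.<⇒≤ k<D)) (line (suc k) k<D)) →
    (mid≤D : mid ≤ D) → e ≤ mid → mid + e ≤ D →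
    (∀ v → (∃[ k ] Σ[ k≤D ∈ k ≤ D ] v ≡ line k k≤D) ⊎ Within v e (line mid mid≤D)) →
    HasUndirectedDiameter G D
  line-diameter {D} {mid} {e} φ lip line φ-line link-line mid≤D e≤mid mid+e≤D place =
    (λ u v → close (within u v)) ,
    -- Walked from D down to 0, since `length-lipschitz` bounds the drop of φ along a path.
    line D ℕ.≤-refl , line 0 z≤n , far (close (within (line D ℕ.≤-refl) (line 0 z≤n)))
    where
    along : ∀ i j k .(j≤D : j ≤ D) .(k≤D : k ≤ D) → i + j ≡ k → Within (line j j≤D) i (line k k≤D)
    along zero    j _ j≤D k≤D refl = within-refl
    along (suc i) j _ j≤D k≤D refl = within-mono (ℕ.≤-reflexive (ℕ.+-comm i 1))
      (within-trans (along i j (i + j) j≤D (ℕ.<⇒≤ k≤D) refl) (within-link (link-line (i + j) k≤D)))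

    between : ∀ j k .(j≤D : j ≤ D) .(k≤D : k ≤ D) → j ≤ k → Within (line j j≤D) (k ∸ j) (line k k≤D)
    between j k j≤D k≤D j≤k = along (k ∸ j) j k j≤D k≤D (ℕ.m∸n+n≡m j≤k)

    -- Leaves a budget of `e` for going on from the middle to a vertex off the line. Two vertices
    -- off the line need 2 e ≤ mid + e ≤ D.
    middle : ∀ j .(j≤D : j ≤ D) → j ≤ D → Within (line j j≤D) (D ∸ e) (line mid mid≤D)
    middle j j≤D j≤D′ with ℕ.≤-total j mid
    ... | inj₁ j≤mid = within-mono (ℕ.≤-trans (ℕ.m∸n≤m mid j) (ℕ.m+n≤o⇒m≤o∸n mid mid+e≤D))
                         (between j mid j≤D mid≤D j≤mid)
    ... | inj₂ mid≤j = within-mono (ℕ.∸-mono j≤D′ e≤mid)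
                         (within-sym (between mid j mid≤D j≤D mid≤j))

    e≤D : e ≤ D
    e≤D = ℕ.≤-trans e≤mid mid≤D

    within : ∀ u v → Within u D v
    within u v with place u | place v
    ... | inj₁ (j , j≤D , refl) | inj₁ (k , k≤D , refl) with ℕ.≤-total j k
    ...   | inj₁ j≤k = within-mono (ℕ.≤-trans (ℕ.m∸n≤m k j) k≤D) (between j k j≤D k≤D j≤k)
    ...   | inj₂ k≤j = within-mono (ℕ.≤-trans (ℕ.m∸n≤m j k) j≤D) (within-sym (between k j k≤D j≤D k≤j))
    within u v | inj₁ (j , j≤D , refl) | inj₂ b =
      within-mono (ℕ.≤-reflexive (ℕ.m∸n+n≡m e≤D)) (within-trans (middle j j≤D j≤D) (within-sym b))
    within u v | inj₂ a | inj₁ (k , k≤D , refl) =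
      within-mono (ℕ.≤-reflexive (ℕ.m+[n∸m]≡n e≤D)) (within-trans a (within-sym (middle k k≤D k≤D)))
    within u v | inj₂ a | inj₂ b =
      within-mono (ℕ.≤-trans (ℕ.+-monoˡ-≤ e e≤mid) mid+e≤D) (within-trans a (within-sym b))

    close : ∀ {u v} → Within u D v → ∃[ d ] (IsDistance (Link G) u v d × d ≤ D)
    close (p , p≤D) = let d , dist , d≤p = shortest (λ u v → Bool.T? (link G u v)) p
                      in  d , dist , ℕ.≤-trans d≤p p≤D

    far : ∃[ d ] (IsDistance (Link G) (line D ℕ.≤-refl) (line 0 z≤n) d × d ≤ D) →
          IsDistance (Link G) (line D ℕ.≤-refl) (line 0 z≤n) D
    far (d , dist@((p , refl) , _) , d≤D) = subst (IsDistance (Link G) _ _) (ℕ.≤-antisym d≤D D≤d) dist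
      where
      D≤d : D ≤ length p
      D≤d = subst₂ _≤_ (φ-line D ℕ.≤-refl)
        (trans (cong (_+_ (length p)) (φ-line 0 z≤n)) (ℕ.+-identityʳ _)) (length-lipschitz φ lip p)

module _ {n} {G G′ : Digraph n} {s t v : Fin n} (same : localInput G s t v ≡ localInput G′ s t v) where

  private
    edge-out : ∀ u → edge G v u ≡ edge G′ v u
    edge-out u = trans (sym (Vec.lookup∘tabulate (edge G v) u))
      (trans (cong (λ i → lookup (outNbrs i) u) same) (Vec.lookup∘tabulate (edge G′ v) u))

    edge-in : ∀ u → edge G u v ≡ edge G′ u v
    edge-in u = trans (sym (Vec.lookup∘tabulate (λ u → edge G u v) u))
      (trans (cong (λ i → lookup (inNbrs i) u) same) (Vec.lookup∘tabulate (λ u → edge G′ u v) u))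

  localInput-link : ∀ u → link G u v ≡ link G′ u v
  localInput-link u = cong₂ _∨_ (edge-in u) (edge-out u)

localInput-cong : ∀ {n} (G G′ : Digraph n) {s t v} →
  (∀ u → edge G v u ≡ edge G′ v u) → (∀ u → edge G u v ≡ edge G′ u v) →
  localInput G s t v ≡ localInput G′ s t v
localInput-cong G G′ {s} {t} {v} out inn = cong₂
  (λ o i → record { self = v ; source = s ; target = t ; outNbrs = o ; inNbrs = i })
  (Vec.tabulate-cong out) (Vec.tabulate-cong inn)

module _ {A n b} (𝒜 : Algorithm A n b) where
  open Algorithm 𝒜

  after-zero-cong : ∀ (G G′ : Digraph n) {s t ω ω′ v} → localInput G s t v ≡ localInput G′ s t v →
    finToFun ω v ≡ finToFun ω′ v → after 0 G s t ω v ≡ after 0 G′ s t ω′ v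
  after-zero-cong G G′ = cong₂ init

  -- Messages have to agree on actual links only: equal local inputs give `v` the same neighbours in
  -- both graphs, and everyone else contributes silence.
  after-suc-cong : ∀ i (G G′ : Digraph n) {s t ω ω′ v} → localInput G s t v ≡ localInput G′ s t v →
    after i G s t ω v ≡ after i G′ s t ω′ v →
    (∀ u → Link G u v → message (after i G s t ω u) v ≡ message (after i G′ s t ω′ u) v) →
    after (suc i) G s t ω v ≡ after (suc i) G′ s t ω′ v
  after-suc-cong i G G′ {s} {t} {ω} {ω′} {v} same state messages =
    cong₂ update state (Vec.tabulate-cong received)
    where
    received : ∀ u → (if link G u v then message (after i G s t ω u) v else silence) ≡
                     (if link G′ u v then message (after i G′ s t ω′ u) v else silence)
    received u rewrite sym (localInput-link {G = G} {G′} {s} {t} same u) with link G u v | messages u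
    ... | true  | m = m _
    ... | false | m = refl

-- A finite distance is read as the claim of reachability, so that both problems are treated as one
-- from here on.
says : (P : Problem) → Answer P → Bool
says reachability b        = b
says distance     (just _) = true
says distance     nothing  = false

Correct⇒Reflects : ∀ {n} P {G : Digraph n} {s t} a → Correct P G s t a → Reflects (Star (Edge G) s t) (says P a)
Correct⇒Reflects reachability a        c                 = c
Correct⇒Reflects distance     (just d) ((p , _) , _) = ofʸ p
Correct⇒Reflects distance     nothing  c                 = ofⁿ c

module _ (P : Problem) {n b} (𝒜 : Algorithm (Answer P) n b) where
  open Algorithm 𝒜

  announcesYes : Node → Bool
  announcesYes (inj₁ _)        = false
  announcesYes (inj₂ nothing)  = false
  announcesYes (inj₂ (just a)) = says P a

  module _ (G : Digraph n) (s t : Fin n) (r : ℕ) (ω : Outcome) (ok : Succeeds (Correct P G s t) r G s t ω) where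

    -- With `yes-sound`: on a successful outcome, t is reachable exactly when some vertex announces
    -- yes. Which vertex does so is left open, as the success criterion prescribes none.
    success-yes : Star (Edge G) s t → ∃[ v ] announcesYes (after r G s t ω v) ≡ true
    success-yes p with proj₁ ok
    ... | v , a , eq = v , trans (cong announcesYes eq)
      (det (Correct⇒Reflects P a (proj₂ ok v a eq)) (ofʸ p))

    yes-sound : ∀ v → announcesYes (after r G s t ω v) ≡ true → Star (Edge G) s t
    yes-sound v yea with after r G s t ω v in eq
    ... | inj₂ (just a) = invert (subst (Reflects _) yea (Correct⇒Reflects P a (proj₂ ok v a eq)))

T-does : {P : Set} (P? : Dec P) → T (does P?) → P
T-does (yes p) _ = p

does-T : {P : Set} (P? : Dec P) → P → T (does P?)
does-T (yes _) _ = _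
does-T (no ¬p) p = contradiction p ¬p

-- The diameter term

module _ {N : ℕ} where

  private
    ∑-bound : ∀ (f : Fin N → ℤ) c → (∀ i → f i ℤ.≤ + c) → ∑ (allFin N) f ℤ.≤ + (N * c)
    ∑-bound f c f≤c = ℤ.≤-trans (∑-mono (allFin N) f≤c) (ℤ.≤-reflexive
      (trans (∑-const (+ c) (allFin N)) (trans (cong (λ l → + l ℤ.* + c) (length-allFin N)) (sym (ℤ.pos-* N c)))))

    ∈-dec : ∀ (p : Subset N) i → lookup p i ≡ true → i ∈ p
    ∈-dec p i = Vec.lookup⇒[]= i p

  disjoint-pair : (p q : Subset N) → (∀ i → i ∈ p → i ∉ q) → ∣ p ∣ + ∣ q ∣ ≤ N
  disjoint-pair p q disjoint = ℤ.drop‿+≤+ (subst₂ ℤ._≤_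
    (trans (∑-+ (allFin N) _ _) (trans (cong₂ ℤ._+_ (∑-ind-lookup p) (∑-ind-lookup q)) (sym (ℤ.pos-+ (∣ p ∣) (∣ q ∣)))))
    (cong +_ (ℕ.*-identityʳ N))
    (∑-bound (λ i → ind (lookup p i) ℤ.+ ind (lookup q i)) 1 pointwise))
    where
    pointwise : ∀ i → ind (lookup p i) ℤ.+ ind (lookup q i) ℤ.≤ + 1
    pointwise i with lookup p i in p-i | lookup q i in q-i
    ... | false | false = ℤ.+≤+ z≤n
    ... | false | true  = ℤ.≤-refl
    ... | true  | false = ℤ.≤-refl
    ... | true  | true  = contradiction (∈-dec q i q-i) (disjoint i (∈-dec p i p-i))

  -- No outcome is counted three times, and `j` is counted at most once; adding the indicator of `j`
  -- thus keeps every count at most 2.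
  disjoint-triple : (p q r : Subset N) → (∀ i → i ∈ p → i ∈ q → i ∉ r) →
                    ∀ j → j ∉ q → j ∉ r → ∣ p ∣ + ∣ q ∣ + ∣ r ∣ + 1 ≤ N * 2
  disjoint-triple p q r disjoint j j∉q j∉r = ℤ.drop‿+≤+ (subst (ℤ._≤ + (N * 2)) total
    (∑-bound (λ i → ind (lookup p i) ℤ.+ ind (lookup q i) ℤ.+ ind (lookup r i) ℤ.+ ind (does (j Fin.≟ i)) ℤ.* 1ℤ) 2 pointwise))
    where
    total : ∑ (allFin N) (λ i → ind (lookup p i) ℤ.+ ind (lookup q i) ℤ.+ ind (lookup r i) ℤ.+ ind (does (j Fin.≟ i)) ℤ.* 1ℤ) ≡
            + (∣ p ∣ + ∣ q ∣ + ∣ r ∣ + 1)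
    total = trans (∑-+ (allFin N) _ _) (cong₂ ℤ._+_
      (trans (∑-+ (allFin N) _ _) (cong₂ ℤ._+_
        (trans (∑-+ (allFin N) _ _) (cong₂ ℤ._+_ (∑-ind-lookup p) (∑-ind-lookup q)))
        (∑-ind-lookup r)))
      (∑-ind-≟ j 1ℤ))
    pointwise : ∀ i → ind (lookup p i) ℤ.+ ind (lookup q i) ℤ.+ ind (lookup r i) ℤ.+ ind (does (j Fin.≟ i)) ℤ.* 1ℤ ℤ.≤ + 2
    pointwise i with j Fin.≟ i | lookup p i in p-i | lookup q i in q-i | lookup r i in r-i
    ... | yes refl | _     | true  | _     = contradiction (∈-dec q i q-i) j∉q
    ... | yes refl | _     | false | true  = contradiction (∈-dec r i r-i) j∉r
    ... | yes refl | false | false | false = ℤ.+≤+ (s≤s z≤n)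
    ... | yes refl | true  | false | false = ℤ.≤-refl
    ... | no _     | true  | true  | true  = contradiction (∈-dec r i r-i) (disjoint i (∈-dec p i p-i) (∈-dec q i q-i))
    ... | no _     | false | false | false = ℤ.+≤+ z≤n
    ... | no _     | false | false | true  = ℤ.+≤+ (s≤s z≤n)
    ... | no _     | false | true  | false = ℤ.+≤+ (s≤s z≤n)
    ... | no _     | false | true  | true  = ℤ.≤-refl
    ... | no _     | true  | false | false = ℤ.+≤+ (s≤s z≤n)
    ... | no _     | true  | false | true  = ℤ.≤-refl
    ... | no _     | true  | true  | false = ℤ.≤-refl

  -- The two probabilities add up to at least 4/3, which is more than disjoint events allow.
  common-outcome : .{{_ : NonZero N}} → (p q : Subset N) → 2 * N ≤ 3 * ∣ p ∣ → 2 * N ≤ 3 * ∣ q ∣ → ∃[ i ] (i ∈ p × i ∈ q)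
  common-outcome p q p-large q-large with Fin.any? (λ i → (i ∈? p) ×-dec (i ∈? q))
  ... | yes found = found
  ... | no none = contradiction
    (ℕ.≤-trans (subst₂ _≤_ (four N) (sym (ℕ.*-distribˡ-+ 3 (∣ p ∣) (∣ q ∣))) (ℕ.+-mono-≤ p-large q-large))
      (ℕ.*-monoʳ-≤ 3 (disjoint-pair p q (λ i i∈p i∈q → none (i , i∈p , i∈q)))))
    (ℕ.<⇒≱ (ℕ.m<n+m (3 * N) (>-nonZero⁻¹ N)))
    where
    four : ∀ n → 2 * n + 2 * n ≡ n + 3 * n
    four = ℕ-Solver.solve-∀

  -- The three sizes add up to at least 2 N, so an outcome missed by two of the
  -- events would force another one to lie in all three.
  no-double-miss : (p q r : Subset N) → 2 * N ≤ 3 * ∣ p ∣ → 2 * N ≤ 3 * ∣ q ∣ → 2 * N ≤ 3 * ∣ r ∣ →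
                   (∀ i → i ∈ p → i ∈ q → i ∉ r) → ∀ j → j ∉ q → ¬ j ∉ r
  no-double-miss p q r p-large q-large r-large disjoint j j∉q j∉r =
    ℕ.<⇒≱ (ℕ.m<m+n (6 * N) (s≤s (z≤n {2}))) (begin
      6 * N + 3                           ≡⟨ split N ⟩
      2 * N + 2 * N + 2 * N + 3           ≤⟨ ℕ.+-monoˡ-≤ 3 (ℕ.+-mono-≤ (ℕ.+-mono-≤ p-large q-large) r-large) ⟩
      3 * ∣ p ∣ + 3 * ∣ q ∣ + 3 * ∣ r ∣ + 3 ≡⟨ factor (∣ p ∣) (∣ q ∣) (∣ r ∣) ⟩
      3 * (∣ p ∣ + ∣ q ∣ + ∣ r ∣ + 1)       ≤⟨ ℕ.*-monoʳ-≤ 3 (disjoint-triple p q r disjoint j j∉q j∉r) ⟩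
      3 * (N * 2)                         ≡⟨ six N ⟩
      6 * N                               ∎)
    where
    open ℕ.≤-Reasoning
    split : ∀ n → 6 * n + 3 ≡ 2 * n + 2 * n + 2 * n + 3
    split = ℕ-Solver.solve-∀
    factor : ∀ a b c → 3 * a + 3 * b + 3 * c + 3 ≡ 3 * (a + b + c + 1)
    factor = ℕ-Solver.solve-∀
    six : ∀ n → 3 * (n * 2) ≡ 6 * n
    six = ℕ-Solver.solve-∀

-- The vertices 0, …, D form a line; all others hang off its vertex mid.
position : ℕ → ℕ → ℕ → ℕ
position D mid i = if does (i ℕ.≤? D) then i else mid

position-line : ∀ {D mid i} → i ≤ D → position D mid i ≡ i
position-line {D} {mid} {i} i≤D = cong (if_then i else mid) (dec-true (i ℕ.≤? D) i≤D)

position-pad : ∀ {D mid i} → D < i → position D mid i ≡ mid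
position-pad {D} {mid} {i} D<i = cong (if_then i else mid) (dec-false (i ℕ.≤? D) (ℕ.<⇒≱ D<i))

-- All links of the line may be traversed backwards, so that x and y affect
-- reachability only and not the diameter.
module Chain (n D mid : ℕ) (0<mid : 0 < mid) (mid<D : mid < D) (D<n : D < n) where

  Open : Bool → Bool → ℕ → Set
  Open x y i = (i ≡ 0 → x ≡ true) × (suc i ≡ D → y ≡ true)

  data Step (x y : Bool) (i j : ℕ) : Set where
    forward  : j ≡ suc i → j ≤ D → Open x y i → Step x y i j
    backward : i ≡ suc j → i ≤ D → Step x y i j
    pad      : D < i → j ≡ mid → Step x y i j

  abstract
    step? : ∀ x y i j → Dec (Step x y i j)
    step? x y i j = map′
      (λ { (inj₁ (e , l , o)) → forward e l o ; (inj₂ (inj₁ (e , l))) → backward e l ; (inj₂ (inj₂ (l , e))) → pad l e })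
      (λ { (forward e l o) → inj₁ (e , l , o) ; (backward e l) → inj₂ (inj₁ (e , l)) ; (pad l e) → inj₂ (inj₂ (l , e)) })
      (((j ℕ.≟ suc i) ×-dec (j ℕ.≤? D) ×-dec
          (((i ℕ.≟ 0) →-dec (x Bool.≟ true)) ×-dec ((suc i ℕ.≟ D) →-dec (y Bool.≟ true)))) ⊎-dec
       ((i ℕ.≟ suc j) ×-dec (i ℕ.≤? D)) ⊎-dec
       ((D ℕ.<? i) ×-dec (j ℕ.≟ mid)))

  graph : Bool → Bool → Digraph n
  graph x y = record
    { edge     = λ u v → does (step? x y (toℕ u) (toℕ v))
    ; loopless = λ v → dec-false (step? x y (toℕ v) (toℕ v)) λ
        { (forward e _ _) → ℕ.1+n≢n (sym e) ; (backward e _) → ℕ.1+n≢n (sym e)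
        ; (pad D<v refl) → ℕ.<-asym D<v mid<D }
    }

  step : ∀ x y {u v} → Edge (graph x y) u v → Step x y (toℕ u) (toℕ v)
  step x y {u} {v} = T-does (step? x y (toℕ u) (toℕ v))

  edge-from : ∀ x y {u v} → Step x y (toℕ u) (toℕ v) → Edge (graph x y) u v
  edge-from x y {u} {v} = does-T (step? x y (toℕ u) (toℕ v))

  position-step : ∀ {x y i j} → Step x y i j →
    position D mid i ≤ suc (position D mid j) × position D mid j ≤ suc (position D mid i)
  position-step (forward refl j≤D _) rewrite position-line {D} {mid} j≤D | position-line {D} {mid} (ℕ.<⇒≤ j≤D) =
    ℕ.m≤n⇒m≤1+n (ℕ.n≤1+n _) , ℕ.≤-refl
  position-step (backward refl i≤D) rewrite position-line {D} {mid} i≤D | position-line {D} {mid} (ℕ.<⇒≤ i≤D) =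
    ℕ.≤-refl , ℕ.m≤n⇒m≤1+n (ℕ.n≤1+n _)
  position-step (pad D<i refl) rewrite position-pad {D} {mid} D<i | position-line {D} {mid} (ℕ.<⇒≤ mid<D) = ℕ.n≤1+n _ , ℕ.n≤1+n _

  φ : Fin n → ℕ
  φ v = position D mid (toℕ v)

  φ-lipschitz : ∀ x y {u v} → Link (graph x y) u v → φ u ≤ suc (φ v)
  φ-lipschitz x y {u} {v} l with Link⇒Edge⊎Edge (graph x y) {u} {v} l
  ... | inj₁ e = proj₁ (position-step (step x y {u} {v} e))
  ... | inj₂ e = proj₂ (position-step (step x y {v} {u} e))

  line : ∀ k → .(k ≤ D) → Fin n
  line k k≤D = fromℕ< (ℕ.≤-<-trans k≤D D<n)

  toℕ-line : ∀ k .(k≤D : k ≤ D) → toℕ (line k k≤D) ≡ k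
  toℕ-line k k≤D = Fin.toℕ-fromℕ< _

  diameter : ∀ x y → HasUndirectedDiameter (graph x y) D
  diameter x y = line-diameter (graph x y) φ (λ {u} {v} → φ-lipschitz x y {u} {v}) line
    (λ k k≤D → trans (cong (position D mid) (toℕ-line k k≤D)) (position-line (recompute (k ℕ.≤? D) k≤D)))
    -- The backward edge is present for all values of `x` and `y`.
    (λ k k<D → Link-sym (graph x y) {line (suc k) k<D} {line k (ℕ.<⇒≤ k<D)}
      (Edge⇒Link (graph x y) {line (suc k) k<D} {line k (ℕ.<⇒≤ k<D)}
        (edge-from x y {line (suc k) k<D} {line k (ℕ.<⇒≤ k<D)} (subst₂ (Step x y)
          (sym (toℕ-line (suc k) k<D)) (sym (toℕ-line k (ℕ.<⇒≤ k<D)))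
          (backward refl (recompute (suc k ℕ.≤? D) k<D))))))
    (ℕ.<⇒≤ mid<D) 0<mid (subst (_≤ D) (ℕ.+-comm 1 mid) mid<D) place
    where
    place : ∀ v → (∃[ k ] Σ[ k≤D ∈ k ≤ D ] v ≡ line k k≤D) ⊎ Within (graph x y) v 1 (line mid (ℕ.<⇒≤ mid<D))
    place v with toℕ v ℕ.≤? D
    ... | yes v≤D = inj₁ (toℕ v , v≤D , Fin.toℕ-injective (sym (toℕ-line (toℕ v) v≤D)))
    ... | no v≰D  = inj₂ (within-link (graph x y) (Edge⇒Link (graph x y) {v} {line mid (ℕ.<⇒≤ mid<D)}
                      (edge-from x y {v} {line mid (ℕ.<⇒≤ mid<D)} (pad (ℕ.≰⇒> v≰D) (toℕ-line mid (ℕ.<⇒≤ mid<D))))))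

  s t : Fin n
  s = line 0 z≤n
  t = line D ℕ.≤-refl

  reachable : Star (Edge (graph true true)) s t
  reachable = go D ℕ.≤-refl
    where
    go : ∀ k .(k≤D : k ≤ D) → Star (Edge (graph true true)) s (line k k≤D)
    go zero    k≤D = ε
    go (suc k) k≤D = go k (ℕ.<⇒≤ k≤D) ◅◅ (edge-from true true {line k (ℕ.<⇒≤ k≤D)} {line (suc k) k≤D}
      (subst₂ (Step true true) (sym (toℕ-line k (ℕ.<⇒≤ k≤D))) (sym (toℕ-line (suc k) k≤D))
        (forward refl (recompute (suc k ℕ.≤? D) k≤D) ((λ _ → refl) , λ _ → refl))) ◅ ε)

  0≢D : 0 ≢ D
  0≢D refl = contradiction mid<D λ ()

  -- No edge leaves position 0: the forward one is closed, and there is no position before it.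
  blocked-start : ∀ y → ¬ Star (Edge (graph false y)) s t
  blocked-start y p = 0≢D (trans (sym (Star-invariant (λ v → toℕ v ≡ 0) (λ {u} {v} → closed {u} {v}) p (toℕ-line 0 z≤n)))
                                  (toℕ-line D ℕ.≤-refl))
    where
    closed : ∀ {u v} → Edge (graph false y) u v → toℕ u ≡ 0 → toℕ v ≡ 0
    closed {u} {v} e u≡0 with toℕ u | toℕ v | u≡0 | step false y {u} {v} e
    ... | _ | _ | refl | forward _ _ (o , _) = contradiction (o refl) λ ()

  -- No edge enters position D: the forward one is closed, a backward one would start beyond the
  -- line, and the padding edges lead to `mid`.
  blocked-end : ∀ x → ¬ Star (Edge (graph x false)) s t
  blocked-end x p = Star-invariant (λ v → toℕ v ≢ D) (λ {u} {v} → closed {u} {v}) p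
    (λ s≡D → 0≢D (trans (sym (toℕ-line 0 z≤n)) s≡D)) (toℕ-line D ℕ.≤-refl)
    where
    closed : ∀ {u v} → Edge (graph x false) u v → toℕ u ≢ D → toℕ v ≢ D
    closed {u} {v} e u≢D v≡D with toℕ u | toℕ v | v≡D | step x false {u} {v} e
    ... | _ | _ | refl | forward D≡1+u _ (_ , o) = contradiction (o (sym D≡1+u)) λ ()
    ... | _ | _ | refl | backward refl D<D = ℕ.n≮n _ D<D
    ... | _ | _ | refl | pad _ D≡mid = ℕ.<⇒≢ mid<D (sym D≡mid)

  -- x is visible at the positions 0 and 1 only, and y at D ∸ 1 and D only.
  input-right : ∀ x x′ y v → 2 ≤ φ v → localInput (graph x y) s t v ≡ localInput (graph x′ y) s t v
  input-right x x′ y v 2≤φ = localInput-cong (graph x y) (graph x′ y)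
    (λ u → does-⇔ (mk⇔ (out x x′) (out x′ x)) (step? x y (toℕ v) (toℕ u)) (step? x′ y (toℕ v) (toℕ u)))
    (λ u → does-⇔ (mk⇔ (inn x x′) (inn x′ x)) (step? x y (toℕ u) (toℕ v)) (step? x′ y (toℕ u) (toℕ v)))
    where
    far : ∀ {i} → i < 2 → toℕ v ≢ i
    far {i} i<2 refl = ℕ.<⇒≱ i<2 (subst (2 ≤_) (position-line {D} {mid} {i} (ℕ.≤-trans (ℕ.≤-pred i<2) (ℕ.≤-trans 0<mid (ℕ.<⇒≤ mid<D)))) 2≤φ)
    out : ∀ x x′ {j} → Step x y (toℕ v) j → Step x′ y (toℕ v) j
    out x x′ (forward e l (_ , o)) = forward e l ((λ v≡0 → contradiction v≡0 (far (s≤s z≤n))) , o)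
    out x x′ (backward e l) = backward e l
    out x x′ (pad l e) = pad l e
    inn : ∀ x x′ {j} → Step x y j (toℕ v) → Step x′ y j (toℕ v)
    inn x x′ (forward e l (_ , o)) = forward e l ((λ { refl → contradiction e (far (s≤s (s≤s z≤n))) }) , o)
    inn x x′ (backward e l) = backward e l
    inn x x′ (pad l e) = pad l e

  input-left : ∀ x y y′ v → 2 + φ v ≤ D → localInput (graph x y) s t v ≡ localInput (graph x y′) s t v
  input-left x y y′ v φ+2≤D = localInput-cong (graph x y) (graph x y′)
    (λ u → does-⇔ (mk⇔ (out y y′) (out y′ y)) (step? x y (toℕ v) (toℕ u)) (step? x y′ (toℕ v) (toℕ u)))
    (λ u → does-⇔ (mk⇔ (inn y y′) (inn y′ y)) (step? x y (toℕ u) (toℕ v)) (step? x y′ (toℕ u) (toℕ v)))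
    where
    far : toℕ v ≤ D → D ≤ suc (toℕ v) → ∀ {A : Set} → A
    far v≤D D≤1+v = contradiction (ℕ.≤-trans (subst (λ i → 2 + i ≤ D) (position-line v≤D) φ+2≤D) D≤1+v) (ℕ.n≮n _)
    out : ∀ y y′ {j} → Step x y (toℕ v) j → Step x y′ (toℕ v) j
    out y y′ (forward refl l (o , _)) = forward refl l (o , λ e → far (ℕ.<⇒≤ l) (ℕ.≤-reflexive (sym e)))
    out y y′ (backward e l) = backward e l
    out y y′ (pad l e) = pad l e
    inn : ∀ y y′ {j} → Step x y j (toℕ v) → Step x y′ j (toℕ v)
    inn y y′ (forward e l (o , _)) = forward e l (o , λ f → far l (ℕ.m≤n⇒m≤1+n (ℕ.≤-reflexive (sym (trans e f)))))
    inn y y′ (backward e l) = backward e l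
    inn y y′ (pad l e) = pad l e

  module _ {A b} (𝒜 : Algorithm A n b) where
    open Algorithm 𝒜

    -- Information moves by at most one position per round. After `i` rounds a vertex at c + i or
    -- beyond depends only on inputs and coins at positions from `c` on, where `x` is invisible. The
    -- bound `c` is a parameter so that coins may be exchanged to the left of any chosen position.
    local-right : ∀ x x′ y (ω ω′ : Outcome) {c} → 2 ≤ c → (∀ v → c ≤ φ v → finToFun ω v ≡ finToFun ω′ v) →
      ∀ i v → c + i ≤ φ v → after i (graph x y) s t ω v ≡ after i (graph x′ y) s t ω′ v
    local-right x x′ y ω ω′ {c} 2≤c coins≡ zero v c≤φ = after-zero-cong 𝒜 (graph x y) (graph x′ y) {s} {t} {ω} {ω′} {v}
      (input-right x x′ y v (ℕ.≤-trans 2≤c (ℕ.m+n≤o⇒m≤o c c≤φ))) (coins≡ v (ℕ.m+n≤o⇒m≤o c c≤φ))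
    local-right x x′ y ω ω′ {c} 2≤c coins≡ (suc i) v c≤φ =
      after-suc-cong 𝒜 i (graph x y) (graph x′ y) {s} {t} {ω} {ω′} {v}
      (input-right x x′ y v (ℕ.≤-trans 2≤c (ℕ.m+n≤o⇒m≤o c c≤φ)))
      (local-right x x′ y ω ω′ 2≤c coins≡ i v (ℕ.≤-trans (ℕ.+-monoʳ-≤ c (ℕ.n≤1+n i)) c≤φ))
      (λ u l → cong (λ m → message m v) (local-right x x′ y ω ω′ 2≤c coins≡ i u
        (ℕ.≤-pred (ℕ.≤-trans (subst (_≤ φ v) (ℕ.+-suc c i) c≤φ)
          (φ-lipschitz x y {v} {u} (Link-sym (graph x y) {u} {v} l))))))

    local-left : ∀ x y y′ (ω ω′ : Outcome) {c} → 2 + c ≤ D → (∀ v → φ v ≤ c → finToFun ω v ≡ finToFun ω′ v) →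
      ∀ i v → φ v + i ≤ c → after i (graph x y) s t ω v ≡ after i (graph x y′) s t ω′ v
    local-left x y y′ ω ω′ {c} c+2≤D coins≡ zero v φ≤c = after-zero-cong 𝒜 (graph x y) (graph x y′) {s} {t} {ω} {ω′} {v}
      (input-left x y y′ v (ℕ.≤-trans (ℕ.+-monoʳ-≤ 2 (ℕ.m+n≤o⇒m≤o (φ v) φ≤c)) c+2≤D)) (coins≡ v (ℕ.m+n≤o⇒m≤o (φ v) φ≤c))
    local-left x y y′ ω ω′ {c} c+2≤D coins≡ (suc i) v φ≤c =
      after-suc-cong 𝒜 i (graph x y) (graph x y′) {s} {t} {ω} {ω′} {v}
      (input-left x y y′ v (ℕ.≤-trans (ℕ.+-monoʳ-≤ 2 (ℕ.m+n≤o⇒m≤o (φ v) φ≤c)) c+2≤D))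
      (local-left x y y′ ω ω′ c+2≤D coins≡ i v (ℕ.≤-trans (ℕ.+-monoʳ-≤ (φ v) (ℕ.n≤1+n i)) φ≤c))
      (λ u l → cong (λ m → message m v) (local-left x y y′ ω ω′ c+2≤D coins≡ i u
        (ℕ.≤-trans (ℕ.+-monoˡ-≤ i (φ-lipschitz x y {u} {v} l)) (subst (_≤ c) (ℕ.+-suc (φ v) i) φ≤c))))

  -- A valid announcer sits within r + 1 of one of the ends, and its view reaches r positions
  -- further. The margins keep each view on its own side of `mid`.
  module _ (P : Problem) {b r} (𝒜 : Algorithm (Answer P) n b) (solves : SolvesWithin P D r 𝒜)
           (left : suc (r + r) < mid) (right : mid + suc (suc (r + r)) ≤ D) where
    open Algorithm 𝒜

    private
      S : Bool → Bool → Subset (coins ^ n)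
      S x y = proj₁ (proj₂ (solves (graph x y) (diameter x y) s t))

      S-large : ∀ x y → 2 * coins ^ n ≤ 3 * ∣ S x y ∣
      S-large x y = proj₂ (proj₂ (proj₂ (solves (graph x y) (diameter x y) s t)))

      S-succeeds : ∀ x y {ω} → ω ∈ S x y → Succeeds (Correct P (graph x y) s t) r (graph x y) s t ω
      S-succeeds x y = proj₁ (proj₂ (proj₂ (solves (graph x y) (diameter x y) s t)))

      Yes : Bool → Bool → Outcome → Fin n → Set
      Yes x y ω v = announcesYes P 𝒜 (after r (graph x y) s t ω v) ≡ true

      not-false-true : ∀ ω v → Yes false true ω v → ω ∉ S false true
      not-false-true ω v yea ω∈ = blocked-start true (yes-sound P 𝒜 (graph false true) s t r ω (S-succeeds false true ω∈) v yea)

      not-true-false : ∀ ω v → Yes true false ω v → ω ∉ S true false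
      not-true-false ω v yea ω∈ = blocked-end true (yes-sound P 𝒜 (graph true false) s t r ω (S-succeeds true false ω∈) v yea)

      announcer : ∀ {ω} → ω ∈ S true true → ∃[ v ] Yes true true ω v
      announcer {ω} ω∈ = success-yes P 𝒜 (graph true true) s t r ω (S-succeeds true true ω∈) reachable

      -- From position r + 2 on, the announcer could not tell that `x` was switched off, and its yes
      -- would be wrong on an outcome that succeeds for (false, true).
      announcer-left : ∀ {ω} v → Yes true true ω v → ω ∈ S false true → φ v < 2 + r
      announcer-left {ω} v yea ω∈ = ℕ.≰⇒> λ 2+r≤φ → not-false-true ω v
        (subst (λ m → announcesYes P 𝒜 m ≡ true)
          (local-right 𝒜 true false true ω ω ℕ.≤-refl (λ _ _ → refl) r v 2+r≤φ) yea) ω∈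

      announcer-right : ∀ {ω} v → Yes true true ω v → ω ∈ S true false → D < 2 + (φ v + r)
      announcer-right {ω} v yea ω∈ = ℕ.≰⇒> λ φ+r+2≤D → not-true-false ω v
        (subst (λ m → announcesYes P 𝒜 m ≡ true)
          (local-left 𝒜 true true false ω ω φ+r+2≤D (λ _ _ → refl) r v ℕ.≤-refl) yea) ω∈

      left-and-right : ∀ v → φ v < 2 + r → ¬ D < 2 + (φ v + r)
      left-and-right v v-left v-right = ℕ.<⇒≱ v-right (begin
        2 + (φ v + r)           ≤⟨ ℕ.+-monoʳ-≤ 2 (ℕ.+-monoˡ-≤ r (ℕ.≤-pred v-left)) ⟩
        2 + (suc r + r)         ≤⟨ s≤s left ⟩
        suc mid                 ≤⟨ mid<D ⟩
        D                       ∎)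
        where open ℕ.≤-Reasoning

      -- An announcer on (true, true) would have to be close to both ends.
      disjoint : ∀ ω → ω ∈ S true true → ω ∈ S true false → ω ∉ S false true
      disjoint ω ω∈₁₁ ω∈₁₀ ω∈₀₁ =
        let v , yea = announcer ω∈₁₁
        in  left-and-right v (announcer-left v yea ω∈₀₁) (announcer-right v yea ω∈₁₀)

    -- An outcome on which the left end announces and one on which the right
    -- end announces are spliced at mid; the splice fails on two inputs.
    too-fast : ⊥
    too-fast =
      let ω , ω∈₁₁ , ω∈₀₁ = common-outcome {{ℕ.m^n≢0 coins n}} (S true true) (S false true)
                              (S-large true true) (S-large false true)
          ω′ , ω′∈₁₁ , ω′∈₁₀ = common-outcome {{ℕ.m^n≢0 coins n}} (S true true) (S true false)
                              (S-large true true) (S-large true false)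
          v , yea = announcer ω∈₁₁
          v′ , yea′ = announcer ω′∈₁₁
      in  spliced ω ω∈₀₁ v yea ω′ ω′∈₁₀ v′ yea′
      where
      spliced : ∀ ω → ω ∈ S false true → ∀ v → Yes true true ω v →
                ∀ ω′ → ω′ ∈ S true false → ∀ v′ → Yes true true ω′ v′ → ⊥
      spliced ω ω∈₀₁ v yea ω′ ω′∈₁₀ v′ yea′ =
        no-double-miss (S true true) (S true false) (S false true)
          (S-large true true) (S-large true false) (S-large false true) disjoint splice
          -- The splice has the coins of ω up to `mid`, so `v` still says yes on (true, false);
          -- beyond `mid` it has those of ω′, so `v′` still says yes on (false, true). Both answers
          -- are wrong, and the splice is missed by two of the three events.
          (not-true-false splice v (subst (λ m → announcesYes P 𝒜 m ≡ true)
            (local-left 𝒜 true true false ω splice {mid} mid+2≤D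
              (λ u φ≤ → sym (trans (splice-coins u) (splice-left u φ≤))) r v v-left) yea))
          (not-false-true splice v′ (subst (λ m → announcesYes P 𝒜 m ≡ true)
            (local-right 𝒜 true false true ω′ splice {suc mid} (s≤s 0<mid)
              (λ u φ> → sym (trans (splice-coins u) (splice-right u φ>))) r v′ v′-right) yea′))
        where
        open ℕ.≤-Reasoning
        choose : Fin n → Fin coins
        choose u = if does (φ u ℕ.≤? mid) then finToFun ω u else finToFun ω′ u
        splice : Outcome
        splice = funToFin choose
        splice-coins : ∀ u → finToFun splice u ≡ choose u
        splice-coins = Fin.finToFun-funToFin choose
        splice-left : ∀ u → φ u ≤ mid → choose u ≡ finToFun ω u
        splice-left u φ≤ = cong (if_then finToFun ω u else finToFun ω′ u) (dec-true (φ u ℕ.≤? mid) φ≤)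
        splice-right : ∀ u → mid < φ u → choose u ≡ finToFun ω′ u
        splice-right u φ> = cong (if_then finToFun ω u else finToFun ω′ u) (dec-false (φ u ℕ.≤? mid) (ℕ.<⇒≱ φ>))
        mid+2≤D : 2 + mid ≤ D
        mid+2≤D = ℕ.≤-trans (subst (_≤ mid + suc (suc (r + r))) (ℕ.+-comm mid 2) (ℕ.+-monoʳ-≤ mid (s≤s (s≤s z≤n)))) right
        v-left : φ v + r ≤ mid
        v-left = ℕ.≤-trans (ℕ.+-monoˡ-≤ r (ℕ.≤-pred (announcer-left v yea ω∈₀₁))) (ℕ.<⇒≤ left)
        v′-right : suc mid + r ≤ φ v′
        v′-right = ℕ.+-cancelʳ-≤ (suc r) (suc mid + r) (φ v′) (begin
          suc mid + r + suc r       ≡⟨ shuffle mid r ⟩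
          mid + suc (suc (r + r))   ≤⟨ right ⟩
          D                         ≤⟨ ℕ.≤-pred (announcer-right v′ yea′ ω′∈₁₀) ⟩
          suc (φ v′ + r)            ≡⟨ ℕ.+-suc (φ v′) r ⟨
          φ v′ + suc r              ∎)
          where
          shuffle : ∀ a b → suc a + b + suc b ≡ a + suc (suc (b + b))
          shuffle = ℕ-Solver.solve-∀

-- For D ≥ 4 r + 4 the choice mid = 2 r + 2 leaves the required margin on both sides.
diameter-bound : ∀ P {n D r b} → D < n → (𝒜 : Algorithm (Answer P) n b) → SolvesWithin P D r 𝒜 → D < 4 * r + 4
diameter-bound P {n} {D} {r} {b} D<n 𝒜 solves = ℕ.≰⇒> λ 4r+4≤D →
  let right = subst (_≤ D) (halves r) 4r+4≤D
      mid<D = ℕ.<-≤-trans (ℕ.m<m+n (suc (suc (r + r))) (s≤s z≤n)) right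
  in  Chain.too-fast n D (suc (suc (r + r))) (s≤s z≤n) mid<D D<n P {b} {r} 𝒜 solves ℕ.≤-refl right
  where
  halves : ∀ r → 4 * r + 4 ≡ suc (suc (r + r)) + suc (suc (r + r))
  halves = ℕ-Solver.solve-∀

-- The vertices of the lower bound graph

-- `a` kinds of rows with `b` layers each and `c` tree levels, all of `d` columns, and `e` further
-- vertices. Tree levels have full width, which makes the number of vertices a plain product.
Vertex : (a b c d e : ℕ) → Set
Vertex a b c d e = ((Fin a × Fin b) ⊎ Fin c) × Fin d ⊎ Fin e

vertices : ∀ a b c d e → Fin ((a * b + c) * d + e) ↔ Vertex a b c d e
vertices a b c d e =
  ((((Fin.*↔× ⊎-↔ ↔-id _) ↔-∘ Fin.+↔⊎ {a * b} {c}) ×-↔ ↔-id _) ↔-∘ Fin.*↔× {a * b + c} {d} ⊎-↔ ↔-id _) ↔-∘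
  Fin.+↔⊎ {(a * b + c) * d} {e}

-- fwd i p and bwd i p are the rows of the branching program that carry the
-- partial inner product p of the first i bits towards the holder of y and back
-- towards the holder of x; the last argument is the column.  tree j a is the
-- a-th vertex of level j, above the columns a 2ʲ, …, (a + 1) 2ʲ - 1.
data Node : Set where
  fwd bwd : (i : ℕ) (p : Bool) (c : ℕ) → Node
  tree    : (j a : ℕ) → Node
  aux     : (k : ℕ) → Node

module _ (m h ℓ rest : ℕ) where

  Valid : Node → Set
  Valid (fwd i p c) = i ≤ m × c ≤ ℓ
  Valid (bwd i p c) = i ≤ m × c ≤ ℓ
  Valid (tree j a)  = j ≤ h × a ≤ ℓ
  Valid (aux k)     = k < rest

  -- A bijection between the identifiers and the valid nodes. Validity is irrelevant in `enc`, so a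
  -- vertex depends on its node alone.
  record Layout (n : ℕ) : Set where
    field
      dec       : Fin n → Node
      enc       : (u : Node) → .(Valid u) → Fin n
      dec-valid : ∀ v → Valid (dec v)
      dec-enc   : ∀ u .(ok : Valid u) → dec (enc u ok) ≡ u
      enc-dec   : ∀ v → enc (dec v) (dec-valid v) ≡ v

  layout : Layout ((4 * suc m + suc h) * suc ℓ + rest)
  layout = record
    { dec       = λ v → node (to v)
    ; enc       = λ u ok → from (vertex u ok)
    ; dec-valid = λ v → valid (to v)
    ; dec-enc   = λ u ok → trans (cong node (strictlyInverseˡ (vertex u ok))) (node-vertex u ok)
    ; enc-dec   = λ v → trans (cong from (vertex-node (to v) (valid (to v)))) (strictlyInverseʳ v)
    }
    where
    open Inverse (vertices 4 (suc m) (suc h) (suc ℓ) rest)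

    row : Fin 4 → ℕ → ℕ → Node
    row zero                   i c = fwd i false c
    row (suc zero)             i c = fwd i true c
    row (suc (suc zero))       i c = bwd i false c
    row (suc (suc (suc zero))) i c = bwd i true c

    node : Vertex 4 (suc m) (suc h) (suc ℓ) rest → Node
    node (inj₁ (inj₁ (d , i) , c)) = row d (toℕ i) (toℕ c)
    node (inj₁ (inj₂ j , a))       = tree (toℕ j) (toℕ a)
    node (inj₂ k)                  = aux (toℕ k)

    cell : Fin 4 → ∀ i c → .(i ≤ m × c ≤ ℓ) → Vertex 4 (suc m) (suc h) (suc ℓ) rest
    cell d i c ok = inj₁ (inj₁ (d , fromℕ< (s≤s (proj₁ ok))) , fromℕ< (s≤s (proj₂ ok)))

    vertex : (u : Node) → .(Valid u) → Vertex 4 (suc m) (suc h) (suc ℓ) rest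
    vertex (fwd i false c) ok = cell zero i c ok
    vertex (fwd i true c)  ok = cell (suc zero) i c ok
    vertex (bwd i false c) ok = cell (suc (suc zero)) i c ok
    vertex (bwd i true c)  ok = cell (suc (suc (suc zero))) i c ok
    vertex (tree j a)      ok = inj₁ (inj₂ (fromℕ< (s≤s (proj₁ ok))) , fromℕ< (s≤s (proj₂ ok)))
    vertex (aux k)         ok = inj₂ (fromℕ< ok)

    node-cell : ∀ d i c .(ok : i ≤ m × c ≤ ℓ) → node (cell d i c ok) ≡ row d i c
    node-cell d i c ok = cong₂ (row d) (Fin.toℕ-fromℕ< _) (Fin.toℕ-fromℕ< _)

    node-vertex : ∀ u .(ok : Valid u) → node (vertex u ok) ≡ u
    node-vertex (fwd i false c) ok = node-cell zero i c ok
    node-vertex (fwd i true c)  ok = node-cell (suc zero) i c ok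
    node-vertex (bwd i false c) ok = node-cell (suc (suc zero)) i c ok
    node-vertex (bwd i true c)  ok = node-cell (suc (suc (suc zero))) i c ok
    node-vertex (tree j a)      ok = cong₂ tree (Fin.toℕ-fromℕ< _) (Fin.toℕ-fromℕ< _)
    node-vertex (aux k)         ok = cong aux (Fin.toℕ-fromℕ< _)

    below : ∀ {k} (i : Fin (suc k)) → toℕ i ≤ k
    below i = ℕ.≤-pred (Fin.toℕ<n i)

    valid : ∀ v → Valid (node v)
    valid (inj₁ (inj₁ (zero                 , i) , c)) = below i , below c
    valid (inj₁ (inj₁ (suc zero             , i) , c)) = below i , below c
    valid (inj₁ (inj₁ (suc (suc zero)       , i) , c)) = below i , below c
    valid (inj₁ (inj₁ (suc (suc (suc zero)) , i) , c)) = below i , below c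
    valid (inj₁ (inj₂ j , a))                          = below j , below a
    valid (inj₂ k)                                     = Fin.toℕ<n k

    cell-toℕ : ∀ d i c .(ok : toℕ i ≤ m × toℕ c ≤ ℓ) → cell d (toℕ i) (toℕ c) ok ≡ inj₁ (inj₁ (d , i) , c)
    cell-toℕ d i c ok = cong₂ (λ i c → inj₁ (inj₁ (d , i) , c)) (Fin.fromℕ<-toℕ i _) (Fin.fromℕ<-toℕ c _)

    vertex-node : ∀ v .(ok : Valid (node v)) → vertex (node v) ok ≡ v
    vertex-node (inj₁ (inj₁ (zero                 , i) , c)) ok = cell-toℕ _ i c ok
    vertex-node (inj₁ (inj₁ (suc zero             , i) , c)) ok = cell-toℕ _ i c ok
    vertex-node (inj₁ (inj₁ (suc (suc zero)       , i) , c)) ok = cell-toℕ _ i c ok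
    vertex-node (inj₁ (inj₁ (suc (suc (suc zero)) , i) , c)) ok = cell-toℕ _ i c ok
    vertex-node (inj₁ (inj₂ j , a)) ok = cong₂ (λ j a → inj₁ (inj₂ j , a)) (Fin.fromℕ<-toℕ j _) (Fin.fromℕ<-toℕ a _)
    vertex-node (inj₂ k)            ok = cong inj₂ (Fin.fromℕ<-toℕ k _)

  module _ {n} (lay : Layout n) where
    open Layout lay

    enc-cong : ∀ {u u′} .(ok : Valid u) .(ok′ : Valid u′) → u ≡ u′ → enc u ok ≡ enc u′ ok′
    enc-cong ok ok′ refl = refl

    enc-unique : ∀ u .(ok : Valid u) v → dec v ≡ u → v ≡ enc u ok
    enc-unique _ ok v refl = sym (enc-dec v)

-- The lower bound graph

bit : ∀ {m} → Vec Bool m → ℕ → Bool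
bit []      i       = false
bit (a ∷ x) zero    = a
bit (a ∷ x) (suc i) = bit x i

-- Accumulates from index 0 upwards, as the branching program does, whereas `_∙_` peels off the
-- first bit, as the Walsh recursion does.
parity : ∀ {m} → Vec Bool m → Vec Bool m → ℕ → Bool
parity x y zero    = false
parity x y (suc i) = parity x y i xor (bit x i ∧ bit y i)

parity-∷ : ∀ {m} a b (x y : Vec Bool m) i → parity (a ∷ x) (b ∷ y) (suc i) ≡ (a ∧ b) xor parity x y i
parity-∷ a b x y zero    = sym (Bool.xor-identityʳ (a ∧ b))
parity-∷ a b x y (suc i) = trans (cong (_xor (bit x i ∧ bit y i)) (parity-∷ a b x y i))
                                 (Bool.xor-assoc (a ∧ b) (parity x y i) _)

parity-∙ : ∀ {m} (x y : Vec Bool m) → parity x y m ≡ x ∙ y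
parity-∙ []      []      = refl
parity-∙ {suc m} (a ∷ x) (b ∷ y) = trans (parity-∷ a b x y m) (cong ((a ∧ b) xor_) (parity-∙ x y))

-- This is ⌊ q / 2ʲ ⌋, the number of complete blocks of 2ʲ columns among the first `q`.
half : ℕ → ℕ → ℕ
half zero    q = q
half (suc j) q = ⌊ half j q /2⌋

half-mono : ∀ j {q q′} → q ≤ q′ → half j q ≤ half j q′
half-mono zero    q≤q′ = q≤q′
half-mono (suc j) q≤q′ = ℕ.⌊n/2⌋-mono (half-mono j q≤q′)

half-≤ : ∀ j q → half j q ≤ q
half-≤ zero    q = ℕ.≤-refl
half-≤ (suc j) q = ℕ.≤-trans (ℕ.⌊n/2⌋≤n (half j q)) (half-≤ j q)

half-0 : ∀ {i j q} → half i q ≡ 0 → i ≤ j → half j q ≡ 0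
half-0 {i} {j} {q} eq i≤j = go (ℕ.≤⇒≤′ i≤j)
  where
  go : ∀ {j} → i ≤′ j → half j q ≡ 0
  go ≤′-refl       = eq
  go (≤′-step i≤j) = cong ⌊_/2⌋ (go i≤j)

⌊/2⌋-cancel-< : ∀ {a b} → ⌊ a /2⌋ < ⌊ b /2⌋ → a < b
⌊/2⌋-cancel-< a<b = ℕ.≰⇒> λ b≤a → ℕ.<⇒≱ a<b (ℕ.⌊n/2⌋-mono b≤a)

-- Distinct numbers whose halves do not grow are siblings. This leaves only one candidate for a
-- crossing link on each tree level.
⌊/2⌋-sandwich : ∀ {a b} → a < b → ⌊ b /2⌋ ≤ ⌊ a /2⌋ → b ≡ suc a × ⌊ a /2⌋ ≡ ⌊ b /2⌋
⌊/2⌋-sandwich {zero}        {suc zero}    _ _ = refl , refl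
⌊/2⌋-sandwich {zero}        {suc (suc b)} _ ()
⌊/2⌋-sandwich {suc zero}    {suc zero}    (s≤s ()) _
⌊/2⌋-sandwich {suc zero}    {suc (suc b)} _ ()
⌊/2⌋-sandwich {suc (suc a)} {suc (suc b)} (s≤s (s≤s a<b)) (s≤s b≤a) =
  let b≡ , half≡ = ⌊/2⌋-sandwich a<b b≤a in cong (λ k → suc (suc k)) b≡ , cong suc half≡

-- Every link between Left q and the complement of Left (suc q) is one of the
-- at most h tree links between childNode q j and parentNode q j.
Left : ℕ → Node → Set
Left q (fwd _ _ c) = c < q
Left q (bwd _ _ c) = c < q
Left q (tree j a)  = a < half j q
Left q (aux _)     = ⊥

left? : ∀ q u → Dec (Left q u)
left? q (fwd _ _ c) = c ℕ.<? q
left? q (bwd _ _ c) = c ℕ.<? q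
left? q (tree j a)  = a ℕ.<? half j q
left? q (aux _)     = no λ ()

left-mono : ∀ {q q′} → q ≤ q′ → ∀ u → Left q u → Left q′ u
left-mono q≤q′ (fwd _ _ c) c<q = ℕ.≤-trans c<q q≤q′
left-mono q≤q′ (bwd _ _ c) c<q = ℕ.≤-trans c<q q≤q′
left-mono q≤q′ (tree j a)  a<  = ℕ.≤-trans a< (half-mono j q≤q′)

parentNode : ℕ → ℕ → Node
parentNode q j = tree (suc j) (half (suc j) q)

-- If half j q is 0 there is no such link, and tree 0 0 is a placeholder.
childNode : ℕ → ℕ → Node
childNode q j with half j q
... | zero  = tree 0 0
... | suc a = tree j a

parent-right : ∀ {q q′} j → q ≤ q′ → ¬ Left q (parentNode q′ j)
parent-right j q≤q′ = ℕ.≤⇒≯ (half-mono (suc j) q≤q′)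

child-left : ∀ {q} j → 0 < q → Left q (childNode q j)
child-left {q} j 0<q with half j q in eq
... | zero  = 0<q
... | suc a = ℕ.≤-reflexive (sym eq)

-- `half-h` says that no block of 2ʰ columns fits into the ℓ + 1 columns; level `h` of the tree
-- therefore lies to the right of every cut.
module Network {m h ℓ rest n : ℕ} (lay : Layout m h ℓ rest n) {D mid : ℕ}
               (D<rest : D < rest) (h+3≤mid : h + 3 ≤ mid) (mid+h+3≤D : mid + (h + 3) ≤ D)
               (half-h : half h (suc ℓ) ≡ 0) where
  open Layout lay

  -- Layer i reads bit i. If it is 0 in `x`, `skip` moves on to layer i + 1 at column 0. If it is 1,
  -- the walk runs to column ℓ, where `turn` adds the bit of `y`, and returns to column 0, where
  -- `enter` checks the bit of `x` again, now at index `pred i`. Hence `x` acts in column 0 only and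
  -- `y` in column ℓ only. No edge leads from the tree or the line back to the rows. `merge`
  -- attaches the surplus vertices of the top level.
  data Step (x y : Vec Bool m) : Node → Node → Set where
    forth  : ∀ {i p c i′ p′ c′} → i′ ≡ i → p′ ≡ p → c′ ≡ suc c → Step x y (fwd i p c) (fwd i′ p′ c′)
    back   : ∀ {i p c i′ p′ c′} → i′ ≡ i → p′ ≡ p → c ≡ suc c′ → Step x y (bwd i p c) (bwd i′ p′ c′)
    skip   : ∀ {i p c i′ p′ c′} → bit x i ≡ false → i′ ≡ suc i → p′ ≡ p → c ≡ 0 → c′ ≡ 0 →
             Step x y (fwd i p c) (fwd i′ p′ c′)
    turn   : ∀ {i p c i′ p′ c′} → i′ ≡ suc i → p′ ≡ p xor bit y i → c ≡ ℓ → c′ ≡ ℓ →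
             Step x y (fwd i p c) (bwd i′ p′ c′)
    enter  : ∀ {i p c i′ p′ c′} → bit x (pred i) ≡ true → i′ ≡ i → p′ ≡ p → c ≡ 0 → c′ ≡ 0 →
             Step x y (bwd i p c) (fwd i′ p′ c′)
    leaveᶠ : ∀ {i p c j a} → j ≡ 0 → a ≡ c → Step x y (fwd i p c) (tree j a)
    leaveᵇ : ∀ {i p c j a} → j ≡ 0 → a ≡ c → Step x y (bwd i p c) (tree j a)
    climb  : ∀ {j a j′ a′} → j < h → j′ ≡ suc j → a′ ≡ ⌊ a /2⌋ → Step x y (tree j a) (tree j′ a′)
    merge  : ∀ {j a j′ a′} → j ≡ h → j′ ≡ h → 0 < a → a′ ≡ 0 → Step x y (tree j a) (tree j′ a′)
    root   : ∀ {j a k} → j ≡ h → a ≡ 0 → k ≡ mid → Step x y (tree j a) (aux k)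
    line   : ∀ {k k′} → k < D → k′ ≡ suc k → Step x y (aux k) (aux k′)
    pad    : ∀ {k k′} → D < k → k′ ≡ mid → Step x y (aux k) (aux k′)

  abstract
    step? : ∀ x y u v → Dec (Step x y u v)
    step? x y (fwd i p c) (fwd i′ p′ c′) = map′
      (λ { (inj₁ (a , b , d)) → forth a b d ; (inj₂ (a , b , d , e , f)) → skip a b d e f })
      (λ { (forth a b d) → inj₁ (a , b , d) ; (skip a b d e f) → inj₂ (a , b , d , e , f) })
      (((i′ ℕ.≟ i) ×-dec (p′ Bool.≟ p) ×-dec (c′ ℕ.≟ suc c)) ⊎-dec
       ((bit x i Bool.≟ false) ×-dec (i′ ℕ.≟ suc i) ×-dec (p′ Bool.≟ p) ×-dec (c ℕ.≟ 0) ×-dec (c′ ℕ.≟ 0)))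
    step? x y (bwd i p c) (bwd i′ p′ c′) = map′
      (λ { (a , b , d) → back a b d }) (λ { (back a b d) → a , b , d })
      ((i′ ℕ.≟ i) ×-dec (p′ Bool.≟ p) ×-dec (c ℕ.≟ suc c′))
    step? x y (fwd i p c) (bwd i′ p′ c′) = map′
      (λ { (a , b , d , e) → turn a b d e }) (λ { (turn a b d e) → a , b , d , e })
      ((i′ ℕ.≟ suc i) ×-dec (p′ Bool.≟ (p xor bit y i)) ×-dec (c ℕ.≟ ℓ) ×-dec (c′ ℕ.≟ ℓ))
    step? x y (bwd i p c) (fwd i′ p′ c′) = map′
      (λ { (a , b , d , e , f) → enter a b d e f }) (λ { (enter a b d e f) → a , b , d , e , f })
      ((bit x (pred i) Bool.≟ true) ×-dec (i′ ℕ.≟ i) ×-dec (p′ Bool.≟ p) ×-dec (c ℕ.≟ 0) ×-dec (c′ ℕ.≟ 0))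
    step? x y (fwd i p c) (tree j a) = map′
      (λ { (e , f) → leaveᶠ e f }) (λ { (leaveᶠ e f) → e , f }) ((j ℕ.≟ 0) ×-dec (a ℕ.≟ c))
    step? x y (bwd i p c) (tree j a) = map′
      (λ { (e , f) → leaveᵇ e f }) (λ { (leaveᵇ e f) → e , f }) ((j ℕ.≟ 0) ×-dec (a ℕ.≟ c))
    step? x y (tree j a) (tree j′ a′) = map′
      (λ { (inj₁ (b , d , e)) → climb b d e ; (inj₂ (b , d , e , f)) → merge b d e f })
      (λ { (climb b d e) → inj₁ (b , d , e) ; (merge b d e f) → inj₂ (b , d , e , f) })
      (((j ℕ.<? h) ×-dec (j′ ℕ.≟ suc j) ×-dec (a′ ℕ.≟ ⌊ a /2⌋)) ⊎-dec
       ((j ℕ.≟ h) ×-dec (j′ ℕ.≟ h) ×-dec (0 ℕ.<? a) ×-dec (a′ ℕ.≟ 0)))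
    step? x y (tree j a) (aux k) = map′
      (λ { (b , d , e) → root b d e }) (λ { (root b d e) → b , d , e })
      ((j ℕ.≟ h) ×-dec (a ℕ.≟ 0) ×-dec (k ℕ.≟ mid))
    step? x y (aux k) (aux k′) = map′
      (λ { (inj₁ (a , b)) → line a b ; (inj₂ (a , b)) → pad a b })
      (λ { (line a b) → inj₁ (a , b) ; (pad a b) → inj₂ (a , b) })
      (((k ℕ.<? D) ×-dec (k′ ℕ.≟ suc k)) ⊎-dec ((D ℕ.<? k) ×-dec (k′ ℕ.≟ mid)))
    step? x y (fwd _ _ _) (aux _)     = no λ ()
    step? x y (bwd _ _ _) (aux _)     = no λ ()
    step? x y (tree _ _)  (fwd _ _ _) = no λ ()
    step? x y (tree _ _)  (bwd _ _ _) = no λ ()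
    step? x y (aux _)     (fwd _ _ _) = no λ ()
    step? x y (aux _)     (bwd _ _ _) = no λ ()
    step? x y (aux _)     (tree _ _)  = no λ ()

  mid<D : mid < D
  mid<D = ℕ.<-≤-trans (ℕ.m<m+n mid (ℕ.≤-trans (s≤s z≤n) (ℕ.m≤n+m 3 h))) mid+h+3≤D

  irreflexive : ∀ x y u → ¬ Step x y u u
  irreflexive x y _ (forth _ _ e)    = ℕ.1+n≢n (sym e)
  irreflexive x y _ (back _ _ e)     = ℕ.1+n≢n (sym e)
  irreflexive x y _ (skip _ e _ _ _) = ℕ.1+n≢n (sym e)
  irreflexive x y _ (climb _ e _)    = ℕ.1+n≢n (sym e)
  irreflexive x y _ (merge _ _ l e)  = ℕ.<⇒≢ l (sym e)
  irreflexive x y _ (line _ e)       = ℕ.1+n≢n (sym e)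
  irreflexive x y _ (pad l refl)     = ℕ.<-asym l mid<D

  graph : Vec Bool m → Vec Bool m → Digraph n
  graph x y = record
    { edge     = λ u v → does (step? x y (dec u) (dec v))
    ; loopless = λ v → dec-false (step? x y (dec v) (dec v)) (irreflexive x y (dec v))
    }

  module _ (x y : Vec Bool m) where

    step : ∀ u v → Edge (graph x y) u v → Step x y (dec u) (dec v)
    step u v = T-does (step? x y (dec u) (dec v))

    edge-from : ∀ u v → Step x y (dec u) (dec v) → Edge (graph x y) u v
    edge-from u v = does-T (step? x y (dec u) (dec v))

    step-edge : ∀ {u v} .(u-ok : Valid m h ℓ rest u) .(v-ok : Valid m h ℓ rest v) → Step x y u v →
                Edge (graph x y) (enc u u-ok) (enc v v-ok)
    step-edge {u} {v} u-ok v-ok st = edge-from (enc u u-ok) (enc v v-ok)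
      (subst₂ (Step x y) (sym (dec-enc u u-ok)) (sym (dec-enc v v-ok)) st)

    step-link : ∀ {u} v .(v-ok : Valid m h ℓ rest v) → Step x y (dec u) v → Link (graph x y) u (enc v v-ok)
    step-link {u} v v-ok st = Edge⇒Link (graph x y) {u} {enc v v-ok}
      (edge-from u (enc v v-ok) (subst (Step x y (dec u)) (sym (dec-enc v v-ok)) st))

    link-step : ∀ u v → Link (graph x y) u v → Step x y (dec u) (dec v) ⊎ Step x y (dec v) (dec u)
    link-step u v l with Link⇒Edge⊎Edge (graph x y) {u} {v} l
    ... | inj₁ e = inj₁ (step u v e)
    ... | inj₂ e = inj₂ (step v u e)

  pos : Node → ℕ
  pos (fwd _ _ _) = mid
  pos (bwd _ _ _) = mid
  pos (tree _ _)  = mid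
  pos (aux k)     = position D mid k

  pos-step : ∀ {x y u v} → Step x y u v → pos u ≤ suc (pos v) × pos v ≤ suc (pos u)
  pos-step (forth _ _ _)     = ℕ.n≤1+n _ , ℕ.n≤1+n _
  pos-step (back _ _ _)      = ℕ.n≤1+n _ , ℕ.n≤1+n _
  pos-step (skip _ _ _ _ _)  = ℕ.n≤1+n _ , ℕ.n≤1+n _
  pos-step (turn _ _ _ _)    = ℕ.n≤1+n _ , ℕ.n≤1+n _
  pos-step (enter _ _ _ _ _) = ℕ.n≤1+n _ , ℕ.n≤1+n _
  pos-step (leaveᶠ _ _)      = ℕ.n≤1+n _ , ℕ.n≤1+n _
  pos-step (leaveᵇ _ _)      = ℕ.n≤1+n _ , ℕ.n≤1+n _
  pos-step (climb _ _ _)     = ℕ.n≤1+n _ , ℕ.n≤1+n _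
  pos-step (merge _ _ _ _)   = ℕ.n≤1+n _ , ℕ.n≤1+n _
  pos-step (root _ _ refl) rewrite position-line {D} {mid} (ℕ.<⇒≤ mid<D) = ℕ.n≤1+n _ , ℕ.n≤1+n _
  pos-step (line k<D refl) rewrite position-line {D} {mid} k<D | position-line {D} {mid} (ℕ.<⇒≤ k<D) =
    ℕ.m≤n⇒m≤1+n (ℕ.n≤1+n _) , ℕ.≤-refl
  pos-step (pad D<k refl) rewrite position-pad {D} {mid} D<k | position-line {D} {mid} (ℕ.<⇒≤ mid<D) =
    ℕ.n≤1+n _ , ℕ.n≤1+n _

  aux-ok : ∀ k → k ≤ D → k < rest
  aux-ok k k≤D = ℕ.≤-<-trans k≤D D<rest

  middle : Fin n
  middle = enc (aux mid) (aux-ok mid (ℕ.<⇒≤ mid<D))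

  module _ (x y : Vec Bool m) where

    private
      G = graph x y

    -- `i` climbs to level `h`, then at most one `merge` and the `root` edge. A row vertex needs one
    -- more step to enter the tree, whence h + 3.
    tree-close : ∀ i j a v → j + i ≡ h → dec v ≡ tree j a → Within G v (i + 2) middle
    tree-close zero j zero v j≡h v≡ = within-mono G (s≤s z≤n) (within-link G
      (step-link x y {v} (aux mid) (aux-ok mid (ℕ.<⇒≤ mid<D))
        (subst (λ u → Step x y u (aux mid)) (sym v≡) (root (trans (sym (ℕ.+-identityʳ j)) j≡h) refl refl))))
    tree-close zero j (suc a) v j≡h v≡ = within-trans G {d = 1} {e = 1}
      (within-link G (step-link x y {v} (tree h 0) (ℕ.≤-refl , z≤n)
        (subst (λ u → Step x y u (tree h 0)) (sym v≡) (merge (trans (sym (ℕ.+-identityʳ j)) j≡h) refl (s≤s z≤n) refl))))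
      (within-link G (step-link x y {enc (tree h 0) (ℕ.≤-refl , z≤n)} (aux mid) (aux-ok mid (ℕ.<⇒≤ mid<D))
        (subst (λ u → Step x y u (aux mid)) (sym (dec-enc (tree h 0) (ℕ.≤-refl , z≤n))) (root refl refl refl))))
    tree-close (suc i) j a v j+i≡h v≡ = within-trans G {d = 1}
      (within-link G (step-link x y {v} (tree (suc j) ⌊ a /2⌋) ok
        (subst (λ u → Step x y u (tree (suc j) ⌊ a /2⌋)) (sym v≡) (climb j<h refl refl))))
      (tree-close i (suc j) ⌊ a /2⌋ (enc (tree (suc j) ⌊ a /2⌋) ok) (trans (sym (ℕ.+-suc j i)) j+i≡h) (dec-enc _ ok))
      where
      j<h : j < h
      j<h = subst (j <_) j+i≡h (ℕ.m<m+n j (s≤s z≤n))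
      ok : Valid m h ℓ rest (tree (suc j) ⌊ a /2⌋)
      ok = j<h , ℕ.≤-trans (ℕ.⌊n/2⌋≤n a) (proj₂ (subst (Valid m h ℓ rest) v≡ (dec-valid v)))

    column-close : ∀ c v .(c≤ℓ : c ≤ ℓ) → Step x y (dec v) (tree 0 c) → Within G v (h + 3) middle
    column-close c v c≤ℓ st = within-mono G (ℕ.≤-reflexive (sym (ℕ.+-suc h 2))) (within-trans G {d = 1}
      (within-link G (step-link x y {v} (tree 0 c) (z≤n , c≤ℓ) st))
      (tree-close h 0 c (enc (tree 0 c) (z≤n , c≤ℓ)) refl (dec-enc _ (z≤n , c≤ℓ))))

    diameter : HasUndirectedDiameter G D
    diameter = line-diameter G (pos ∘ dec) lipschitz
      (λ k k≤D → enc (aux k) (aux-ok k k≤D))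
      (λ k k≤D → trans (cong pos (dec-enc (aux k) (aux-ok k k≤D))) (position-line {D} {mid} (recompute (k ℕ.≤? D) k≤D)))
      (λ k k<D → Edge⇒Link G {enc (aux k) (aux-ok k (ℕ.<⇒≤ k<D))} {enc (aux (suc k)) (aux-ok (suc k) k<D)}
        (step-edge x y (aux-ok k (ℕ.<⇒≤ k<D)) (aux-ok (suc k) k<D) (line (recompute (suc k ℕ.≤? D) k<D) refl)))
      (ℕ.<⇒≤ mid<D) h+3≤mid mid+h+3≤D place
      where
      lipschitz : ∀ {u v} → Link G u v → pos (dec u) ≤ suc (pos (dec v))
      lipschitz {u} {v} l with link-step x y u v l
      ... | inj₁ st = proj₁ (pos-step st)
      ... | inj₂ st = proj₂ (pos-step st)
      place : ∀ v → (∃[ k ] Σ[ k≤D ∈ k ≤ D ] v ≡ enc (aux k) (aux-ok k k≤D)) ⊎ Within G v (h + 3) middle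
      place v = go (dec v) refl
        where
        go : ∀ u → dec v ≡ u → (∃[ k ] Σ[ k≤D ∈ k ≤ D ] v ≡ enc (aux k) (aux-ok k k≤D)) ⊎ Within G v (h + 3) middle
        go (fwd i p c) v≡ = inj₂ (column-close c v (proj₂ (subst (Valid m h ℓ rest) v≡ (dec-valid v)))
          (subst (λ u → Step x y u (tree 0 c)) (sym v≡) (leaveᶠ refl refl)))
        go (bwd i p c) v≡ = inj₂ (column-close c v (proj₂ (subst (Valid m h ℓ rest) v≡ (dec-valid v)))
          (subst (λ u → Step x y u (tree 0 c)) (sym v≡) (leaveᵇ refl refl)))
        go (tree j a) v≡ = inj₂ (within-mono G (ℕ.+-mono-≤ (ℕ.m∸n≤m h j) (ℕ.n≤1+n 2))
          (tree-close (h ∸ j) j a v (ℕ.m+[n∸m]≡n (proj₁ (subst (Valid m h ℓ rest) v≡ (dec-valid v)))) v≡))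
        go (aux k) v≡ with k ℕ.≤? D
        ... | yes k≤D = inj₁ (k , k≤D , enc-unique m h ℓ rest lay (aux k) (aux-ok k k≤D) v v≡)
        ... | no k≰D = inj₂ (within-mono G (ℕ.≤-trans (s≤s z≤n) (ℕ.m≤n+m 3 h)) (within-link G
          (step-link x y {v} (aux mid) (aux-ok mid (ℕ.<⇒≤ mid<D))
            (subst (λ u → Step x y u (aux mid)) (sym v≡) (pad (ℕ.≰⇒> k≰D) refl)))))

  -- Reachability computes the inner product

  s t : Fin n
  s = enc (fwd 0 false 0) (z≤n , z≤n)
  t = enc (fwd m true 0) (ℕ.≤-refl , z≤n)

  module _ (x y : Vec Bool m) where

    -- The invariant of all walks from `s`. A backward row of layer i + 1 has bit i of `y` added
    -- unconditionally; this is the right parity once `enter` has checked that bit i of `x` is 1.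
    -- Backward rows of layer 0 are never reached.
    Reached : Node → Set
    Reached (fwd i p c)       = p ≡ parity x y i
    Reached (bwd zero p c)    = ⊥
    Reached (bwd (suc i) p c) = p ≡ parity x y i xor bit y i
    Reached (tree j a)        = ⊤
    Reached (aux k)           = ⊤

    reached-step : ∀ {u v} → Step x y u v → Reached u → Reached v
    reached-step (forth refl refl _) r = r
    reached-step (back {zero} refl refl _) ()
    reached-step (back {suc i} refl refl _) r = r
    reached-step (skip {i} b refl refl _ _) r = trans r (sym (trans
      (cong (λ b → parity x y i xor (b ∧ bit y i)) b) (Bool.xor-identityʳ _)))
    reached-step (turn {i} refl refl _ _) r = cong (_xor bit y i) r
    reached-step (enter {zero} b refl refl _ _) ()
    reached-step (enter {suc i} b refl refl _ _) r = trans r (sym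
      (cong (λ b → parity x y i xor (b ∧ bit y i)) b))
    reached-step (leaveᶠ _ _) r    = _
    reached-step (leaveᵇ _ _) r    = _
    reached-step (climb _ _ _) r   = _
    reached-step (merge _ _ _ _) r = _
    reached-step (root _ _ _) r    = _
    reached-step (line _ _) r      = _
    reached-step (pad _ _) r       = _

    reachable-sound : Star (Edge (graph x y)) s t → x ∙ y ≡ true
    reachable-sound p = trans (sym (parity-∙ x y)) (sym (subst Reached (dec-enc (fwd m true 0) (ℕ.≤-refl , z≤n))
      (Star-invariant (Reached ∘ dec) (λ {u} {v} e → reached-step (step x y u v e)) p
        (subst Reached (sym (dec-enc (fwd 0 false 0) (z≤n , z≤n))) refl))))

    forth-row : ∀ i p c .(i≤m : i ≤ m) .(c≤ℓ : c ≤ ℓ) →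
                Star (Edge (graph x y)) (enc (fwd i p 0) (i≤m , z≤n)) (enc (fwd i p c) (i≤m , c≤ℓ))
    forth-row i p zero    i≤m c≤ℓ = ε
    forth-row i p (suc c) i≤m c≤ℓ = forth-row i p c i≤m (ℕ.<⇒≤ c≤ℓ) ◅◅
      (step-edge x y (i≤m , ℕ.<⇒≤ c≤ℓ) (i≤m , c≤ℓ) (forth refl refl refl) ◅ ε)

    back-row : ∀ i p c .(i≤m : i ≤ m) .(c≤ℓ : c ≤ ℓ) →
               Star (Edge (graph x y)) (enc (bwd i p c) (i≤m , c≤ℓ)) (enc (bwd i p 0) (i≤m , z≤n))
    back-row i p zero    i≤m c≤ℓ = ε
    back-row i p (suc c) i≤m c≤ℓ =
      step-edge x y (i≤m , c≤ℓ) (i≤m , ℕ.<⇒≤ c≤ℓ) (back refl refl refl) ◅ back-row i p c i≤m (ℕ.<⇒≤ c≤ℓ)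

    layer : ∀ i .(i≤m : i ≤ m) → Star (Edge (graph x y)) s (enc (fwd i (parity x y i) 0) (i≤m , z≤n))
    layer zero    i≤m = ε
    layer (suc i) i<m = layer i (ℕ.<⇒≤ i<m) ◅◅ next (bit x i) refl
      where
      next : ∀ b → bit x i ≡ b → Star (Edge (graph x y))
        (enc (fwd i (parity x y i) 0) (ℕ.<⇒≤ i<m , z≤n)) (enc (fwd (suc i) (parity x y (suc i)) 0) (i<m , z≤n))
      next false b = step-edge x y (ℕ.<⇒≤ i<m , z≤n) (i<m , z≤n) (skip b refl
        (trans (cong (λ b → parity x y i xor (b ∧ bit y i)) b) (Bool.xor-identityʳ _)) refl refl) ◅ ε
      next true b = forth-row i _ ℓ (ℕ.<⇒≤ i<m) ℕ.≤-refl ◅◅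
        (step-edge x y (ℕ.<⇒≤ i<m , ℕ.≤-refl) (i<m , ℕ.≤-refl) (turn refl refl refl refl) ◅
         back-row (suc i) (parity x y i xor bit y i) ℓ i<m ℕ.≤-refl) ◅◅
        (step-edge x y (i<m , z≤n) (i<m , z≤n) (enter b refl
          (cong (λ b → parity x y i xor (b ∧ bit y i)) b) refl refl) ◅ ε)

    reachable-complete : x ∙ y ≡ true → Star (Edge (graph x y)) s t
    reachable-complete xy = subst (Star (Edge (graph x y)) s) (enc-cong m h ℓ rest lay (ℕ.≤-refl , z≤n) (ℕ.≤-refl , z≤n)
      (cong (λ p → fwd m p 0) (trans (parity-∙ x y) xy))) (layer m ℕ.≤-refl)

  -- Links across a cut and local views

  half-h-0 : ∀ {q} → q ≤ suc ℓ → ∀ {j} → h ≤ j → half j q ≡ 0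
  half-h-0 {q} q≤ h≤j = half-0 (ℕ.n≤0⇒n≡0 (subst (half h q ≤_) half-h (half-mono h q≤))) h≤j

  Crossing : ℕ → Node → Node → Set
  Crossing q u v = ∃[ j ] (j < h × u ≡ childNode q j × v ≡ parentNode q j)

  -- A row edge changes the column by at most one, which the gap between `q` and `suc q` absorbs,
  -- and `leaveᶠ` and `leaveᵇ` keep the column. Only `climb` can cross, and `⌊/2⌋-sandwich`
  -- identifies its ends.
  crossing-out : ∀ {x y q u v} → q ≤ suc ℓ → Left q u → ¬ Left (suc q) v → Step x y u v → Crossing q u v
  crossing-out q≤ u-left v-right (forth _ _ refl)           = contradiction (s≤s u-left) v-right
  crossing-out q≤ u-left v-right (back _ _ refl)            = contradiction (ℕ.m≤n⇒m≤1+n (ℕ.<⇒≤ u-left)) v-right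
  crossing-out q≤ u-left v-right (skip _ _ _ _ refl)        = contradiction (s≤s z≤n) v-right
  crossing-out q≤ u-left v-right (turn _ _ refl refl)       = contradiction (ℕ.m≤n⇒m≤1+n u-left) v-right
  crossing-out q≤ u-left v-right (enter _ _ _ _ refl)       = contradiction (s≤s z≤n) v-right
  crossing-out q≤ u-left v-right (leaveᶠ refl refl)         = contradiction (ℕ.m≤n⇒m≤1+n u-left) v-right
  crossing-out q≤ u-left v-right (leaveᵇ refl refl)         = contradiction (ℕ.m≤n⇒m≤1+n u-left) v-right
  crossing-out {q = q} q≤ u-left v-right (climb {j} {a} j<h refl refl) =
    j , j<h , child (proj₁ squeezed) , cong (tree (suc j)) (proj₂ squeezed)
    where
    squeezed : half j q ≡ suc a × ⌊ a /2⌋ ≡ half (suc j) q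
    squeezed = ⌊/2⌋-sandwich u-left (ℕ.≤-trans (half-mono (suc j) (ℕ.n≤1+n q)) (ℕ.≮⇒≥ v-right))
    child : half j q ≡ suc a → tree j a ≡ childNode q j
    child eq with half j q | eq
    ... | _ | refl = refl
  crossing-out q≤ u-left v-right (merge {a = a} refl _ _ _) = contradiction (subst (a <_) (half-h-0 q≤ ℕ.≤-refl) u-left) λ ()
  crossing-out q≤ u-left v-right (root {a = a} refl _ _)    = contradiction (subst (a <_) (half-h-0 q≤ ℕ.≤-refl) u-left) λ ()

  -- Tree edges point upwards, and both halves of a complete block are complete, so below a left
  -- parent there are only left children.
  crossing-in : ∀ {x y q u v} → q ≤ suc ℓ → Left q u → ¬ Left (suc q) v → ¬ Step x y v u
  crossing-in q≤ u-left v-right (forth _ _ refl)         = v-right (ℕ.m≤n⇒m≤1+n (ℕ.<⇒≤ u-left))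
  crossing-in q≤ u-left v-right (back _ _ refl)          = v-right (s≤s u-left)
  crossing-in q≤ u-left v-right (skip _ _ _ refl _)      = v-right (s≤s z≤n)
  crossing-in q≤ u-left v-right (turn _ _ refl refl)     = v-right (ℕ.m≤n⇒m≤1+n u-left)
  crossing-in q≤ u-left v-right (enter _ _ _ refl _)     = v-right (s≤s z≤n)
  crossing-in q≤ u-left v-right (leaveᶠ refl refl)       = v-right (ℕ.m≤n⇒m≤1+n u-left)
  crossing-in q≤ u-left v-right (leaveᵇ refl refl)       = v-right (ℕ.m≤n⇒m≤1+n u-left)
  crossing-in {q = q} q≤ u-left v-right (climb {j} _ refl refl) =
    v-right (ℕ.≤-trans (⌊/2⌋-cancel-< u-left) (half-mono j (ℕ.n≤1+n q)))
  crossing-in q≤ u-left v-right (merge {a′ = a′} _ refl _ _) = contradiction (subst (a′ <_) (half-h-0 q≤ ℕ.≤-refl) u-left) λ ()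

  crossing : ∀ x y {q} u v → q ≤ suc ℓ → Left q (dec u) → ¬ Left (suc q) (dec v) → Link (graph x y) u v →
             Crossing q (dec u) (dec v)
  crossing x y u v q≤ u-left v-right l with link-step x y u v l
  ... | inj₁ st = crossing-out q≤ u-left v-right st
  ... | inj₂ st = contradiction st (crossing-in q≤ u-left v-right)

  -- `y` occurs in `turn` only, both of whose ends lie in column ℓ.
  hide-y : ∀ {x y y′ u v} → Left ℓ u ⊎ Left ℓ v → Step x y u v → Step x y′ u v
  hide-y l (forth a b c)             = forth a b c
  hide-y l (back a b c)              = back a b c
  hide-y l (skip a b c d e)          = skip a b c d e
  hide-y (inj₁ l) (turn _ _ refl _)  = contradiction l (ℕ.n≮n ℓ)
  hide-y (inj₂ l) (turn _ _ _ refl)  = contradiction l (ℕ.n≮n ℓ)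
  hide-y l (enter a b c d e)         = enter a b c d e
  hide-y l (leaveᶠ a b)              = leaveᶠ a b
  hide-y l (leaveᵇ a b)              = leaveᵇ a b
  hide-y l (climb a b c)             = climb a b c
  hide-y l (merge a b c d)           = merge a b c d
  hide-y l (root a b c)              = root a b c
  hide-y l (line a b)                = line a b
  hide-y l (pad a b)                 = pad a b

  -- `x` occurs in `skip` and `enter` only, whose ends all lie in column 0.
  hide-x : ∀ {x x′ y u v} → ¬ Left 1 u ⊎ ¬ Left 1 v → Step x y u v → Step x′ y u v
  hide-x l (forth a b c)                  = forth a b c
  hide-x l (back a b c)                   = back a b c
  hide-x (inj₁ l) (skip _ _ _ refl _)     = contradiction (s≤s z≤n) l
  hide-x (inj₂ l) (skip _ _ _ _ refl)     = contradiction (s≤s z≤n) l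
  hide-x l (turn a b c d)                 = turn a b c d
  hide-x (inj₁ l) (enter _ _ _ refl _)    = contradiction (s≤s z≤n) l
  hide-x (inj₂ l) (enter _ _ _ _ refl)    = contradiction (s≤s z≤n) l
  hide-x l (leaveᶠ a b)                   = leaveᶠ a b
  hide-x l (leaveᵇ a b)                   = leaveᵇ a b
  hide-x l (climb a b c)                  = climb a b c
  hide-x l (merge a b c d)                = merge a b c d
  hide-x l (root a b c)                   = root a b c
  hide-x l (line a b)                     = line a b
  hide-x l (pad a b)                      = pad a b

  input-left : ∀ x y y′ v → Left ℓ (dec v) → localInput (graph x y) s t v ≡ localInput (graph x y′) s t v
  input-left x y y′ v l = localInput-cong (graph x y) (graph x y′)
    (λ u → does-⇔ (mk⇔ (hide-y (inj₁ l)) (hide-y (inj₁ l))) (step? x y (dec v) (dec u)) (step? x y′ (dec v) (dec u)))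
    (λ u → does-⇔ (mk⇔ (hide-y (inj₂ l)) (hide-y (inj₂ l))) (step? x y (dec u) (dec v)) (step? x y′ (dec u) (dec v)))

  input-right : ∀ x x′ y v → ¬ Left 1 (dec v) → localInput (graph x y) s t v ≡ localInput (graph x′ y) s t v
  input-right x x′ y v l = localInput-cong (graph x y) (graph x′ y)
    (λ u → does-⇔ (mk⇔ (hide-x (inj₁ l)) (hide-x (inj₁ l))) (step? x y (dec v) (dec u)) (step? x′ y (dec v) (dec u)))
    (λ u → does-⇔ (mk⇔ (hide-x (inj₂ l)) (hide-x (inj₂ l))) (step? x y (dec u) (dec v)) (step? x′ y (dec u) (dec v)))

-- Simulation by a two-party protocol

-- Pads a message with end marks, so that at most `b` bits become exactly `b` letters. Three letters
-- occur; four make the number of codes a power of two.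
slot : ∀ {l} → Vec Bool l → ℕ → Fin 4
slot []          k       = zero
slot (false ∷ v) zero    = suc zero
slot (true ∷ v)  zero    = suc (suc zero)
slot (_ ∷ v)     (suc k) = slot v k

slot-injective : ∀ {l l′} (v : Vec Bool l) (w : Vec Bool l′) b → l ≤ b → l′ ≤ b →
                 (∀ k → k < b → slot v k ≡ slot w k) → _≡_ {A = Σ ℕ (Vec Bool)} (l , v) (l′ , w)
slot-injective []          []          b       _         _          eq = refl
slot-injective []          (false ∷ w) (suc b) _         _          eq = contradiction (eq 0 (s≤s z≤n)) λ ()
slot-injective []          (true ∷ w)  (suc b) _         _          eq = contradiction (eq 0 (s≤s z≤n)) λ ()
slot-injective (false ∷ v) []          (suc b) _         _          eq = contradiction (eq 0 (s≤s z≤n)) λ ()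
slot-injective (true ∷ v)  []          (suc b) _         _          eq = contradiction (eq 0 (s≤s z≤n)) λ ()
slot-injective (false ∷ v) (true ∷ w)  (suc b) _         _          eq = contradiction (eq 0 (s≤s z≤n)) λ ()
slot-injective (true ∷ v)  (false ∷ w) (suc b) _         _          eq = contradiction (eq 0 (s≤s z≤n)) λ ()
slot-injective (false ∷ v) (false ∷ w) (suc b) (s≤s l≤b) (s≤s l′≤b) eq
  with refl ← slot-injective v w b l≤b l′≤b (λ k k<b → eq (suc k) (s≤s k<b)) = refl
slot-injective (true ∷ v)  (true ∷ w)  (suc b) (s≤s l≤b) (s≤s l′≤b) eq
  with refl ← slot-injective v w b l≤b l′≤b (λ k k<b → eq (suc k) (s≤s k<b)) = refl

funToFin-injective : ∀ {m n} (f g : Fin m → Fin n) → funToFin f ≡ funToFin g → ∀ i → f i ≡ g i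
funToFin-injective f g eq i =
  trans (sym (Fin.finToFun-funToFin f i)) (trans (cong (λ k → finToFun k i) eq) (Fin.finToFun-funToFin g i))

funToFin-cong : ∀ {m n} (f g : Fin m → Fin n) → (∀ i → f i ≡ g i) → funToFin f ≡ funToFin g
funToFin-cong {zero}  f g f≡g = refl
funToFin-cong {suc m} f g f≡g = cong₂ combine (f≡g zero) (funToFin-cong (f ∘ suc) (g ∘ suc) (f≡g ∘ suc))

messageCode : ∀ {b} → Message b → Fin (4 ^ b)
messageCode {b} (bounded v _) = funToFin {b} (λ k → slot v (toℕ k))

messageCode-injective : ∀ {b} (μ ν : Message b) → messageCode μ ≡ messageCode ν → μ ≡ ν
messageCode-injective {b} μ@(bounded v _) ν@(bounded w _) eq
  with refl ← slot-injective v w b (isBounded μ) (isBounded ν) (λ k k<b → trans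
    (cong (slot v) (sym (Fin.toℕ-fromℕ< k<b))) (trans
    (funToFin-injective {b} (λ k → slot v (toℕ k)) (λ k → slot w (toℕ k)) eq (fromℕ< k<b))
    (cong (slot w) (Fin.toℕ-fromℕ< k<b)))) = refl

-- Codes are indexed by `Fin`, the simulation by numbers with irrelevant bounds; this passes from
-- the former to the latter.
from-Fin : ∀ {r h} (T : ∀ i j → .(i < r) → .(j < h) → Set) →
           (∀ (i : Fin r) (j : Fin h) → T (toℕ i) (toℕ j) (Fin.toℕ<n i) (Fin.toℕ<n j)) →
           ∀ i j .(i<r : i < r) .(j<h : j < h) → T i j i<r j<h
from-Fin {r} {h} T all i j i<r j<h = go
  {i′<r = Fin.toℕ<n (fromℕ< i<r)} {Fin.toℕ<n (fromℕ< j<h)} (Fin.toℕ-fromℕ< i<r) (Fin.toℕ-fromℕ< j<h) (all (fromℕ< i<r) (fromℕ< j<h))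
  where
  go : ∀ {i′ j′} .{i′<r : i′ < r} .{j′<h : j′ < h} → i′ ≡ i → j′ ≡ j → T i′ j′ i′<r j′<h → T i j i<r j<h
  go refl refl t = t

bitCode : Bool → Fin 2
bitCode false = zero
bitCode true  = suc zero

bitCode-injective : ∀ a b → bitCode a ≡ bitCode b → a ≡ b
bitCode-injective false false eq = refl
bitCode-injective true  true  eq = refl

module Simulation {m h ℓ rest n : ℕ} (lay : Layout m h ℓ rest n) {D mid : ℕ}
                  (D<rest : D < rest) (h+3≤mid : h + 3 ≤ mid) (mid+h+3≤D : mid + (h + 3) ≤ D)
                  (half-h : half h (suc ℓ) ≡ 0)
                  (P : Problem) {b r : ℕ} (r+r<ℓ : r + r < ℓ) (𝒜 : Algorithm (Answer P) n b) where
  open Layout lay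
  open Network lay D<rest h+3≤mid mid+h+3≤D half-h
  open Algorithm 𝒜 renaming (Node to Status)

  -- A verdict bit of either party, and for each round and tree level one message in either
  -- direction.
  transcriptSize : ℕ
  transcriptSize = 2 * (2 * ((4 ^ b * 4 ^ b) ^ h) ^ r)

  child-ok : ∀ {q j} → q ≤ ℓ → j < h → Valid m h ℓ rest (childNode q j)
  child-ok {q} {j} q≤ℓ j<h with half j q in eq
  ... | zero  = z≤n , z≤n
  ... | suc a = ℕ.<⇒≤ j<h , ℕ.≤-trans (ℕ.n≤1+n a) (ℕ.≤-trans (subst (_≤ q) eq (half-≤ j q)) q≤ℓ)

  parent-ok : ∀ {q j} → q ≤ ℓ → j < h → Valid m h ℓ rest (parentNode q j)
  parent-ok {q} {j} q≤ℓ j<h = j<h , ℕ.≤-trans (half-≤ (suc j) q) q≤ℓ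

  round≤ℓ : ∀ {i} → .(i < r) → suc i ≤ ℓ
  round≤ℓ {i} i<r = ℕ.≤-trans (recompute (suc i ℕ.≤? r) i<r) (ℕ.≤-trans (ℕ.m≤m+n r r) (ℕ.<⇒≤ r+r<ℓ))

  -- This is where 2 r < ℓ enters: the regions of the two parties still overlap, so the sender of a
  -- message that one party misses is held by the other.
  cuts-ordered : ∀ {i} → i < r → suc i ≤ ℓ ∸ suc i
  cuts-ordered {i} i<r = ℕ.m+n≤o⇒m≤o∸n (suc i) (ℕ.≤-trans (ℕ.+-mono-≤ i<r i<r) (ℕ.<⇒≤ r+r<ℓ))

  suc-∸-suc : ∀ {i} → i < r → suc (ℓ ∸ suc i) ≡ ℓ ∸ i
  suc-∸-suc i<r = sym (ℕ.+-∸-assoc 1 (round≤ℓ i<r))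

  module _ (ω : Outcome) where

    state : Vec Bool m → Vec Bool m → ℕ → Fin n → Status
    state x y i v = after i (graph x y) s t ω v

    child parent : ∀ q j → .(q ≤ ℓ) → .(j < h) → Fin n
    child q j q≤ℓ j<h = enc (childNode q j) (child-ok q≤ℓ j<h)
    parent q j q≤ℓ j<h = enc (parentNode q j) (parent-ok {q} {j} q≤ℓ j<h)

    -- In round i + 1 the left party loses the column ℓ ∸ suc i and the right
    -- party the column suc i; these are the tree messages they then miss.
    leftward rightward : Vec Bool m → Vec Bool m → ∀ i j → .(i < r) → .(j < h) → Message b
    leftward x y i j i<r j<h = message
      (state x y i (parent (ℓ ∸ suc i) j (ℕ.m∸n≤m ℓ (suc i)) j<h)) (child (ℓ ∸ suc i) j (ℕ.m∸n≤m ℓ (suc i)) j<h)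
    rightward x y i j i<r j<h = message
      (state x y i (child (suc i) j (round≤ℓ i<r) j<h)) (parent (suc i) j (round≤ℓ i<r) j<h)

    module _ {x y x′ y′ : Vec Bool m}
             (same-left  : ∀ i j .(i<r : i < r) .(j<h : j < h) → leftward x y i j i<r j<h ≡ leftward x′ y′ i j i<r j<h)
             (same-right : ∀ i j .(i<r : i < r) .(j<h : j < h) → rightward x y i j i<r j<h ≡ rightward x′ y′ i j i<r j<h) where

      -- The run on the mixed input (x, y′) looks like the one on (x, y) from the left and like the
      -- one on (x′, y′) from the right. Either region shrinks by a column per round.
      KeepsLeft KeepsRight : ℕ → Set
      KeepsLeft i  = ∀ v → Left (ℓ ∸ i) (dec v) → state x y′ i v ≡ state x y i v
      KeepsRight i = ∀ v → ¬ Left (suc i) (dec v) → state x y′ i v ≡ state x′ y′ i v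

      leftward-crossed : ∀ i j (i<r : i < r) .(j<h : j < h) → KeepsRight i →
                         leftward x y′ i j i<r j<h ≡ leftward x′ y′ i j i<r j<h
      leftward-crossed i j i<r j<h keeps = cong
        (λ μ → message μ (child (ℓ ∸ suc i) j (ℕ.m∸n≤m ℓ (suc i)) j<h))
        (keeps (parent (ℓ ∸ suc i) j (ℕ.m∸n≤m ℓ (suc i)) j<h)
          (subst (λ u → ¬ Left (suc i) u) (sym (dec-enc (parentNode (ℓ ∸ suc i) j) _)) (parent-right j (cuts-ordered i<r))))

      rightward-crossed : ∀ i j (i<r : i < r) .(j<h : j < h) → KeepsLeft i →
                          rightward x y′ i j i<r j<h ≡ rightward x y i j i<r j<h
      rightward-crossed i j i<r j<h keeps = cong
        (λ μ → message μ (parent (suc i) j (round≤ℓ i<r) j<h))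
        (keeps (child (suc i) j (round≤ℓ i<r) j<h)
          (subst (Left (ℓ ∸ i)) (sym (dec-enc (childNode (suc i) j) _))
            (left-mono (ℕ.≤-trans (cuts-ordered i<r) (ℕ.∸-monoʳ-≤ ℓ (ℕ.n≤1+n i))) (childNode (suc i) j) (child-left j (s≤s z≤n)))))

      -- A message into the smaller region of the next round comes from the present region or over a
      -- crossing tree link. In the latter case its sender belongs to the other party, and
      -- `same-left` or `same-right` equates the message with the expected one.
      simulate : ∀ i → i ≤ r → KeepsLeft i × KeepsRight i
      simulate zero _ =
        (λ v l → after-zero-cong 𝒜 (graph x y′) (graph x y) {s} {t} {ω} {ω} {v} (input-left x y′ y v l) refl) ,
        (λ v l → after-zero-cong 𝒜 (graph x y′) (graph x′ y′) {s} {t} {ω} {ω} {v} (input-right x x′ y′ v l) refl)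
      simulate (suc i) i<r = left , right
        where
        ih : KeepsLeft i × KeepsRight i
        ih = simulate i (ℕ.<⇒≤ i<r)

        left-message : ∀ u v → Left (ℓ ∸ suc i) (dec v) → Link (graph x y′) u v →
                       message (state x y′ i u) v ≡ message (state x y i u) v
        left-message u v v-left l with left? (ℓ ∸ i) (dec u)
        ... | yes u-left = cong (λ μ → message μ v) (proj₁ ih u u-left)
        ... | no u-right =
          let j , j<h , v≡ , u≡ = crossing x y′ v u (ℕ.m≤n⇒m≤1+n (ℕ.m∸n≤m ℓ (suc i))) v-left
                (subst (λ q → ¬ Left q (dec u)) (sym (suc-∸-suc i<r)) u-right) (Link-sym (graph x y′) {u} {v} l)
          in  subst₂ (λ u v → message (state x y′ i u) v ≡ message (state x y i u) v)
                (sym (enc-unique m h ℓ rest lay _ (parent-ok {ℓ ∸ suc i} {j} (ℕ.m∸n≤m ℓ (suc i)) j<h) u u≡))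
                (sym (enc-unique m h ℓ rest lay _ (child-ok {ℓ ∸ suc i} {j} (ℕ.m∸n≤m ℓ (suc i)) j<h) v v≡))
                (trans (leftward-crossed i j i<r j<h (proj₂ ih)) (sym (same-left i j i<r j<h)))

        right-message : ∀ u v → ¬ Left (suc (suc i)) (dec v) → Link (graph x y′) u v →
                        message (state x y′ i u) v ≡ message (state x′ y′ i u) v
        right-message u v v-right l with left? (suc i) (dec u)
        ... | no u-right = cong (λ μ → message μ v) (proj₂ ih u u-right)
        ... | yes u-left =
          let j , j<h , u≡ , v≡ = crossing x y′ u v (s≤s (ℕ.<⇒≤ (round≤ℓ i<r))) u-left v-right l
          in  subst₂ (λ u v → message (state x y′ i u) v ≡ message (state x′ y′ i u) v)
                (sym (enc-unique m h ℓ rest lay _ (child-ok {suc i} {j} (round≤ℓ i<r) j<h) u u≡))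
                (sym (enc-unique m h ℓ rest lay _ (parent-ok {suc i} {j} (round≤ℓ i<r) j<h) v v≡))
                (trans (rightward-crossed i j i<r j<h (proj₁ ih)) (same-right i j i<r j<h))

        left : KeepsLeft (suc i)
        left v v-left = after-suc-cong 𝒜 i (graph x y′) (graph x y) {s} {t} {ω} {ω} {v}
          (input-left x y′ y v (left-mono (ℕ.m∸n≤m ℓ (suc i)) (dec v) v-left))
          (proj₁ ih v (left-mono (ℕ.∸-monoʳ-≤ ℓ (ℕ.n≤1+n i)) (dec v) v-left))
          (λ u → left-message u v v-left)

        right : KeepsRight (suc i)
        right v v-right = after-suc-cong 𝒜 i (graph x y′) (graph x′ y′) {s} {t} {ω} {ω} {v}
          (input-right x x′ y′ v (v-right ∘ left-mono (s≤s z≤n) (dec v)))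
          (proj₂ ih v (v-right ∘ left-mono (ℕ.n≤1+n (suc i)) (dec v)))
          (λ u → right-message u v v-right)

    Yes : Vec Bool m → Vec Bool m → Fin n → Set
    Yes x y v = announcesYes P 𝒜 (state x y r v) ≡ true

    leftYes? : ∀ x y → Dec (∃[ v ] (Left (ℓ ∸ r) (dec v) × Yes x y v))
    leftYes? x y = Fin.any? (λ v → left? (ℓ ∸ r) (dec v) ×-dec (announcesYes P 𝒜 (state x y r v) Bool.≟ true))

    rightYes? : ∀ x y → Dec (∃[ v ] (¬ Left (suc r) (dec v) × Yes x y v))
    rightYes? x y = Fin.any? (λ v → ¬? (left? (suc r) (dec v)) ×-dec (announcesYes P 𝒜 (state x y r v) Bool.≟ true))

    verdict : Vec Bool m → Vec Bool m → Bool
    verdict x y = does (leftYes? x y) ∨ does (rightYes? x y)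

    roundCode : Vec Bool m → Vec Bool m → Fin r → Fin h → Fin (4 ^ b * 4 ^ b)
    roundCode x y i j = combine
      (messageCode (leftward x y (toℕ i) (toℕ j) (Fin.toℕ<n i) (Fin.toℕ<n j)))
      (messageCode (rightward x y (toℕ i) (toℕ j) (Fin.toℕ<n i) (Fin.toℕ<n j)))

    code : Vec Bool m → Vec Bool m → Fin transcriptSize
    code x y = combine (bitCode (does (leftYes? x y)))
      (combine (bitCode (does (rightYes? x y))) (funToFin (λ i → funToFin (roundCode x y i))))

    module _ {x y x′ y′ : Vec Bool m} (eq : code x y ≡ code x′ y′) where

      private
        split₁ = Fin.combine-injective {2} (bitCode (does (leftYes? x y))) _ (bitCode (does (leftYes? x′ y′))) _ eq
        split₂ = Fin.combine-injective {2} (bitCode (does (rightYes? x y))) _ (bitCode (does (rightYes? x′ y′))) _ (proj₂ split₁)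

      code-left : does (leftYes? x y) ≡ does (leftYes? x′ y′)
      code-left = bitCode-injective _ _ (proj₁ split₁)

      code-right : does (rightYes? x y) ≡ does (rightYes? x′ y′)
      code-right = bitCode-injective _ _ (proj₁ split₂)

      private
        round≡ : ∀ i j → roundCode x y i j ≡ roundCode x′ y′ i j
        round≡ i = funToFin-injective (roundCode x y i) (roundCode x′ y′ i)
          (funToFin-injective (λ i → funToFin (roundCode x y i)) (λ i → funToFin (roundCode x′ y′ i)) (proj₂ split₂) i)

        messages≡ : ∀ i j → let i<r = Fin.toℕ<n i ; j<h = Fin.toℕ<n j in
          leftward x y (toℕ i) (toℕ j) i<r j<h ≡ leftward x′ y′ (toℕ i) (toℕ j) i<r j<h ×
          rightward x y (toℕ i) (toℕ j) i<r j<h ≡ rightward x′ y′ (toℕ i) (toℕ j) i<r j<h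
        messages≡ i j =
          let l , r = Fin.combine-injective {4 ^ b} {4 ^ b}
                (messageCode (leftward x y (toℕ i) (toℕ j) (Fin.toℕ<n i) (Fin.toℕ<n j))) _
                (messageCode (leftward x′ y′ (toℕ i) (toℕ j) (Fin.toℕ<n i) (Fin.toℕ<n j))) _ (round≡ i j)
          in  messageCode-injective _ _ l , messageCode-injective _ _ r

      code-leftward : ∀ i j .(i<r : i < r) .(j<h : j < h) → leftward x y i j i<r j<h ≡ leftward x′ y′ i j i<r j<h
      code-leftward = from-Fin (λ i j i<r j<h → leftward x y i j i<r j<h ≡ leftward x′ y′ i j i<r j<h)
                        (λ i j → proj₁ (messages≡ i j))

      code-rightward : ∀ i j .(i<r : i < r) .(j<h : j < h) → rightward x y i j i<r j<h ≡ rightward x′ y′ i j i<r j<h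
      code-rightward = from-Fin (λ i j i<r j<h → rightward x y i j i<r j<h ≡ rightward x′ y′ i j i<r j<h)
                         (λ i j → proj₂ (messages≡ i j))

      -- The left verdict and the rightward messages are determined by the left region, hence as on
      -- (x, y). The right verdict and the leftward messages are as on (x′, y′), and there they
      -- equal those on (x, y) by `eq`.
      code-rectangular : code x y′ ≡ code x y
      code-rectangular = cong₂ combine
        (cong bitCode (does-⇔ (mk⇔
          (λ { (v , l , a) → v , l , trans (cong (announcesYes P 𝒜) (sym (keepsLeft v l))) a })
          (λ { (v , l , a) → v , l , trans (cong (announcesYes P 𝒜) (keepsLeft v l)) a }))
          (leftYes? x y′) (leftYes? x y)))
        (cong₂ combine
          (cong bitCode (trans (does-⇔ (mk⇔
            (λ { (v , l , a) → v , l , trans (cong (announcesYes P 𝒜) (sym (keepsRight v l))) a })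
            (λ { (v , l , a) → v , l , trans (cong (announcesYes P 𝒜) (keepsRight v l)) a }))
            (rightYes? x y′) (rightYes? x′ y′)) (sym code-right)))
          (funToFin-cong _ _ (λ i → funToFin-cong _ _ (λ j → cong₂ combine
            (cong messageCode (trans
              (leftward-crossed code-leftward code-rightward (toℕ i) (toℕ j) (Fin.toℕ<n i) (Fin.toℕ<n j)
                (proj₂ (simulate code-leftward code-rightward (toℕ i) (ℕ.<⇒≤ (Fin.toℕ<n i)))))
              (sym (code-leftward (toℕ i) (toℕ j) (Fin.toℕ<n i) (Fin.toℕ<n j)))))
            (cong messageCode
              (rightward-crossed code-leftward code-rightward (toℕ i) (toℕ j) (Fin.toℕ<n i) (Fin.toℕ<n j)
                (proj₁ (simulate code-leftward code-rightward (toℕ i) (ℕ.<⇒≤ (Fin.toℕ<n i))))))))))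
        where
        keepsLeft : ∀ v → Left (ℓ ∸ r) (dec v) → state x y′ r v ≡ state x y r v
        keepsLeft = proj₁ (simulate code-leftward code-rightward r ℕ.≤-refl)
        keepsRight : ∀ v → ¬ Left (suc r) (dec v) → state x y′ r v ≡ state x′ y′ r v
        keepsRight = proj₂ (simulate code-leftward code-rightward r ℕ.≤-refl)

    protocol : Protocol m transcriptSize
    protocol = record
      { transcript  = code
      ; output      = verdict
      ; rectangular = code-rectangular
      ; determined  = λ eq → cong₂ _∨_ (code-left eq) (code-right eq)
      }

    verdict-correct : ∀ x y → Succeeds (Correct P (graph x y) s t) r (graph x y) s t ω → verdict x y ≡ x ∙ y
    verdict-correct x y ok with x ∙ y in eq
    ... | true = found (success-yes P 𝒜 (graph x y) s t r ω ok (reachable-complete x y eq))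
      where
      found : ∃[ v ] Yes x y v → verdict x y ≡ true
      found (v , yea) with left? (ℓ ∸ r) (dec v)
      ... | yes l = cong (_∨ does (rightYes? x y)) (dec-true (leftYes? x y) (v , l , yea))
      -- The final regions cover all vertices, because suc r ≤ ℓ ∸ r.
      ... | no l = trans (cong (does (leftYes? x y) ∨_) (dec-true (rightYes? x y)
                     (v , l ∘ left-mono (ℕ.m+n≤o⇒m≤o∸n (suc r) r+r<ℓ) (dec v) , yea))) (Bool.∨-zeroʳ _)
    ... | false = cong₂ _∨_
      (dec-false (leftYes? x y) (λ { (v , _ , yea) → false-alarm v yea }))
      (dec-false (rightYes? x y) (λ { (v , _ , yea) → false-alarm v yea }))
      where
      false-alarm : ∀ v → ¬ Yes x y v
      false-alarm v yea = contradiction (trans (sym eq)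
        (reachable-sound x y (yes-sound P 𝒜 (graph x y) s t r ω ok v yea))) λ ()

  transcripts-bound : ∀ q → m ≡ q + q → SolvesWithin P D r 𝒜 → 2 ^ q ≤ 3 * transcriptSize
  transcripts-bound q m≡ solves = inner-product-bound
    (trans (sym (ℕ.^-distribˡ-+-* 2 q q)) (cong (2 ^_) (sym m≡))) {{ℕ.m^n≢0 coins n}} protocol
    (λ x y → proj₁ (succeeds x y)) (λ x y → proj₂ (proj₂ (succeeds x y)))
    (λ ω x y ω∈ → verdict-correct ω x y (proj₁ (proj₂ (succeeds x y)) (Vec.lookup⇒[]= ω _ ω∈)))
    where
    succeeds : ∀ x y → WithProb≥2/3 (Succeeds (Correct P (graph x y) s t) r (graph x y) s t)
    succeeds x y = proj₂ (solves (graph x y) (diameter x y) s t)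

-- Choice of parameters

n≤2^⌈log₂n⌉ : ∀ n → n ≤ 2 ^ ⌈log₂ n ⌉
n≤2^⌈log₂n⌉ = <-rec _ bound
  where
  bound : ∀ n → (∀ {k} → k < n → k ≤ 2 ^ ⌈log₂ k ⌉) → n ≤ 2 ^ ⌈log₂ n ⌉
  bound zero          rec = z≤n
  bound (suc zero)    rec = ℕ.≤-refl
  bound n@(suc (suc k)) rec = begin
    n                                ≡⟨ ℕ.⌊n/2⌋+⌈n/2⌉≡n n ⟨
    ⌊ n /2⌋ + ⌈ n /2⌉                ≤⟨ ℕ.+-mono-≤ (ℕ.⌊n/2⌋≤⌈n/2⌉ n) (ℕ.m≤m+n ⌈ n /2⌉ 0) ⟩
    2 * ⌈ n /2⌉                      ≤⟨ ℕ.*-monoʳ-≤ 2 (rec (ℕ.⌈n/2⌉<n k)) ⟩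
    2 ^ suc ⌈log₂ ⌈ n /2⌉ ⌉          ≡⟨ cong (λ i → 2 ^ suc i) (⌈log₂⌈n/2⌉⌉≡⌈log₂n⌉∸1 n) ⟩
    2 ^ suc (⌈log₂ n ⌉ ∸ 1)          ≡⟨ cong (2 ^_) (ℕ.m+[n∸m]≡n (⌈log₂⌉-mono-≤ {2} {n} (s≤s (s≤s z≤n)))) ⟩
    2 ^ ⌈log₂ n ⌉                    ∎
    where open ℕ.≤-Reasoning

half-< : ∀ j i q → q < 2 ^ (j + i) → half j q < 2 ^ i
half-< zero    i q q< = q<
half-< (suc j) i q q< = ℕ.≰⇒> λ 2^i≤ → ℕ.<⇒≱ (half-< j (suc i) q (subst (λ k → q < 2 ^ k) (sym (ℕ.+-suc j i)) q<)) (begin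
  2 * 2 ^ i                       ≤⟨ ℕ.*-monoʳ-≤ 2 2^i≤ ⟩
  2 * ⌊ half j q /2⌋              ≡⟨ cong (_+_ ⌊ half j q /2⌋) (ℕ.+-identityʳ _) ⟩
  ⌊ half j q /2⌋ + ⌊ half j q /2⌋ ≤⟨ ℕ.+-monoʳ-≤ ⌊ half j q /2⌋ (ℕ.⌊n/2⌋≤⌈n/2⌉ (half j q)) ⟩
  ⌊ half j q /2⌋ + ⌈ half j q /2⌉ ≡⟨ ℕ.⌊n/2⌋+⌈n/2⌉≡n (half j q) ⟩
  half j q                        ∎)
  where open ℕ.≤-Reasoning

half-vanishes : ∀ j q → q < 2 ^ j → half j q ≡ 0
half-vanishes j q q< = ℕ.n≤0⇒n≡0 (ℕ.≤-pred (half-< j 0 q (subst (λ k → q < 2 ^ k) (sym (ℕ.+-identityʳ j)) q<)))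

-- The messages of a transcript take 4 b h r bits; the 4 pays for the two verdict bits and the
-- factor 3, as 12 < 2⁴.
logSize : ℕ → ℕ → ℕ → ℕ
logSize r b h = 4 * b * h * r + 4

-- The number of row and tree vertices for m = 2 q bits, q being `logSize`, and ℓ = 2 r + 1.
coreSize : ℕ → ℕ → ℕ → ℕ
coreSize r b h = (4 * suc (logSize r b h + logSize r b h) + suc h) * suc (suc (r + r))

transcripts-few : ∀ r b h → 3 * (2 * (2 * ((4 ^ b * 4 ^ b) ^ h) ^ r)) < 2 ^ logSize r b h
transcripts-few r b h = begin-strict
  3 * (2 * (2 * ((4 ^ b * 4 ^ b) ^ h) ^ r)) ≡⟨ cong (λ z → 3 * (2 * (2 * z))) power ⟩
  3 * (2 * (2 * 2 ^ e))                     ≡⟨ twelve (2 ^ e) ⟩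
  2 ^ e * 12                                <⟨ ℕ.*-monoʳ-< (2 ^ e) {{ℕ.m^n≢0 2 e}} (ℕ.m≤m+n 13 3) ⟩
  2 ^ e * 16                                ≡⟨ ℕ.^-distribˡ-+-* 2 e 4 ⟨
  2 ^ (e + 4)                               ∎
  where
  open ℕ.≤-Reasoning
  e = 4 * b * h * r
  twelve : ∀ z → 3 * (2 * (2 * z)) ≡ z * 12
  twelve = ℕ-Solver.solve-∀
  four : ∀ b → 2 * b + 2 * b ≡ 4 * b
  four = ℕ-Solver.solve-∀
  power : ((4 ^ b * 4 ^ b) ^ h) ^ r ≡ 2 ^ e
  power = trans (cong (λ z → (z ^ h) ^ r) (trans (cong₂ _*_ (ℕ.^-*-assoc 2 2 b) (ℕ.^-*-assoc 2 2 b))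
      (trans (sym (ℕ.^-distribˡ-+-* 2 (2 * b) (2 * b))) (cong (2 ^_) (four b)))))
    (trans (cong (_^ r) (ℕ.^-*-assoc 2 (4 * b) h)) (ℕ.^-*-assoc 2 (4 * b * h) r))

-- If the core and D + 1 further vertices fitted, all surplus vertices could be spent on the line
-- and its padding, and the transcripts would be too few. Fitting also gives 2 r + 2 < n ≤ 2ʰ, so a
-- tree of height `h` is high enough.
size-bound : ∀ P {n D r b} h → n ≤ 2 ^ h → (h + 3) + (h + 3) ≤ D →
             (𝒜 : Algorithm (Answer P) n b) → SolvesWithin P D r 𝒜 → n < coreSize r b h + suc D
size-bound P {n} {D} {r} {b} h n≤2^h diam 𝒜 solves = ℕ.≰⇒> λ fits → impossible (n ∸ core)
  (ℕ.m+[n∸m]≡n (ℕ.m+n≤o⇒m≤o core fits)) (ℕ.m+n≤o⇒m≤o∸n (suc D) (subst (_≤ n) (ℕ.+-comm core (suc D)) fits))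
  (ℕ.<-≤-trans (ℕ.≤-<-trans columns≤core (ℕ.<-≤-trans (ℕ.m<m+n core (s≤s z≤n)) fits)) n≤2^h) 𝒜 solves
  where
  q = logSize r b h
  core = coreSize r b h
  columns≤core : suc (suc (r + r)) ≤ core
  columns≤core = ℕ.m≤n*m (suc (suc (r + r))) (4 * suc (q + q) + suc h)
  impossible : ∀ {n} rest → core + rest ≡ n → D < rest → suc (suc (r + r)) < 2 ^ h →
               (𝒜 : Algorithm (Answer P) n b) → ¬ SolvesWithin P D r 𝒜
  impossible rest refl D<rest columns< 𝒜 solves = ℕ.<⇒≱ (transcripts-few r b h)
    -- mid = h + 3 and ℓ = 2 r + 1 are the least values allowed.
    (Simulation.transcripts-bound (layout (q + q) h (suc (r + r)) rest) D<rest (ℕ.≤-refl {h + 3}) diam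
      (half-vanishes h (suc (suc (r + r))) columns<) P {b} {r} ℕ.≤-refl 𝒜 q refl solves)

factor : ℕ → ℕ
factor β = 256 * β + 304

square : ℕ → ℕ
square z = z * z

-- With `r` and `g` written as successors, the difference of the two sides is a polynomial with
-- natural coefficients, displayed in `slack`.
2coreSize≤ : ∀ β r g → 1 ≤ r → 1 ≤ g → 2 * coreSize r (β * g) g ≤ factor β * square (r * g)
2coreSize≤ β (suc r) (suc g) _ _ = subst (2 * coreSize (suc r) (β * suc g) (suc g) ≤_) (slack β r g) (ℕ.m≤m+n _ _)
  where
  slack : ∀ β r g →
    2 * ((4 * suc ((4 * (β * suc g) * suc g * suc r + 4) + (4 * (β * suc g) * suc g * suc r + 4)) + suc (suc g)) * suc (suc (suc r + suc r))) +
    (128 * β * (suc g * suc g) * (suc r * r) + 456 * r + 600 * g + 304 * (r * r) + 304 * (g * g) + 1212 * (r * g) +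
     608 * (r * r * g) + 608 * (r * (g * g)) + 304 * (r * r * (g * g))) ≡
    (256 * β + 304) * ((suc r * suc g) * (suc r * suc g))
  slack = ℕ-Solver.solve-∀

theorem4 : Σ[ C ∈ ℕ ] ((β : ℕ) → ∃[ k ] ∃[ n₀ ]
    ((P : Problem) (n D r : ℕ) → n₀ ≤ n → C * ⌈log₂ n ⌉ ≤ D → D < n →
    (𝒜 : Algorithm (Answer P) n (β * ⌈log₂ n ⌉)) →
    SolvesWithin P D r 𝒜 →
    (k * r) ≥√ n /log+ D))
-- C = 8 makes room for 2 (h + 3) with h = ⌈log₂ n⌉ ≥ 1. In the constant k, the 8 pays for D ≤ 8 r
-- and `factor β` for the square root term.
theorem4 = 8 , λ β → 8 + factor β , 2 , bound β
  where
  bound : ∀ β P n D r → 2 ≤ n → 8 * ⌈log₂ n ⌉ ≤ D → D < n → (𝒜 : Algorithm (Answer P) n (β * ⌈log₂ n ⌉)) →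
          SolvesWithin P D r 𝒜 → ((8 + factor β) * r) ≥√ n /log+ D
  bound β P n D r 2≤n 8g≤D D<n 𝒜 solves =
    ℕ.≤-trans D≤8r (ℕ.*-monoˡ-≤ r (ℕ.m≤m+n 8 (factor β))) ,
    ℕ.≤-trans n≤ (ℕ.^-monoˡ-≤ 2 (ℕ.*-monoˡ-≤ g (ℕ.m+n≤o⇒m≤o∸n (factor β * r) (begin
      factor β * r + D     ≤⟨ ℕ.+-monoʳ-≤ (factor β * r) D≤8r ⟩
      factor β * r + 8 * r ≡⟨ ℕ.+-comm (factor β * r) (8 * r) ⟩
      8 * r + factor β * r ≡⟨ ℕ.*-distribʳ-+ r 8 (factor β) ⟨
      (8 + factor β) * r   ∎))))
    where
    open ℕ.≤-Reasoning
    g = ⌈log₂ n ⌉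
    size = coreSize r (β * g) g

    1≤g : 1 ≤ g
    1≤g = ⌈log₂⌉-mono-≤ 2≤n

    8≤D : 8 ≤ D
    8≤D = ℕ.≤-trans (ℕ.*-monoʳ-≤ 8 1≤g) 8g≤D

    D<4r+4 : D < 4 * r + 4
    D<4r+4 = diameter-bound P {r = r} D<n 𝒜 solves

    1≤r : 1 ≤ r
    1≤r = ℕ.≰⇒> λ r≤0 → ℕ.<⇒≱ (ℕ.<-≤-trans D<4r+4 (ℕ.+-monoˡ-≤ 4 (ℕ.*-monoʳ-≤ 4 r≤0))) (ℕ.≤-trans (ℕ.m≤m+n 4 4) 8≤D)

    D≤8r : D ≤ 8 * r
    D≤8r = begin
      D             ≤⟨ ℕ.<⇒≤ D<4r+4 ⟩
      4 * r + 4     ≤⟨ ℕ.+-monoʳ-≤ (4 * r) (ℕ.*-monoʳ-≤ 4 1≤r) ⟩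
      4 * r + 4 * r ≡⟨ ℕ.*-distribʳ-+ r 4 4 ⟨
      8 * r         ∎

    diam : (g + 3) + (g + 3) ≤ D
    diam = begin
      (g + 3) + (g + 3)         ≤⟨ ℕ.+-mono-≤ g+3≤4g g+3≤4g ⟩
      4 * g + 4 * g             ≡⟨ ℕ.*-distribʳ-+ g 4 4 ⟨
      8 * g                     ≤⟨ 8g≤D ⟩
      D                         ∎
      where
      g+3≤4g : g + 3 ≤ 4 * g
      g+3≤4g = ℕ.+-monoʳ-≤ g (ℕ.*-monoʳ-≤ 3 1≤g)

    tight : n < size + suc D
    tight = size-bound P {r = r} g (n≤2^⌈log₂n⌉ n) diam 𝒜 solves

    A = factor β * r * g

    A≤A² : A ≤ A ^ 2
    A≤A² = subst (A ≤_) (cong (A *_) (sym (ℕ.*-identityʳ A))) (ℕ.m≤m*n A A {{>-nonZero 1≤A}})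
      where
      1≤A : 1 ≤ A
      1≤A = ℕ.*-mono-≤ (ℕ.*-mono-≤ {1} {factor β} {1} (ℕ.≤-trans (ℕ.m≤m+n 1 303) (ℕ.m≤n+m 304 (256 * β))) 1≤r) 1≤g

    small-core : 2 * size ≤ A ^ 2
    small-core = begin
      2 * size                                ≤⟨ 2coreSize≤ β r g 1≤r 1≤g ⟩
      factor β * square (r * g)               ≤⟨ ℕ.*-monoˡ-≤ (square (r * g)) (ℕ.m≤m*n (factor β) (factor β) {{>-nonZero (ℕ.≤-trans (ℕ.m≤m+n 1 303) (ℕ.m≤n+m 304 (256 * β)))}}) ⟩
      factor β * factor β * square (r * g)    ≡⟨ regroup (factor β) r g ⟩
      A ^ 2                                   ∎
      where
      regroup : ∀ f r g → f * f * ((r * g) * (r * g)) ≡ f * r * g * (f * r * g * 1)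
      regroup = ℕ-Solver.solve-∀

    small-line : 2 * suc D ≤ A
    small-line = begin
      2 * suc D           ≤⟨ ℕ.*-monoʳ-≤ 2 (s≤s D≤8r) ⟩
      2 * suc (8 * r)     ≤⟨ ℕ.*-monoʳ-≤ 2 (ℕ.+-monoˡ-≤ (8 * r) 1≤r) ⟩
      2 * (9 * r)         ≡⟨ ℕ.*-assoc 2 9 r ⟨
      18 * r              ≤⟨ ℕ.*-monoˡ-≤ r (ℕ.≤-trans (ℕ.m≤m+n 18 286) (ℕ.m≤n+m 304 (256 * β))) ⟩
      factor β * r        ≤⟨ ℕ.m≤m*n (factor β * r) g {{>-nonZero 1≤g}} ⟩
      A                   ∎

    -- The core and the line take at most half of `A ^ 2` each.
    n≤ : n ≤ A ^ 2
    n≤ = ℕ.*-cancelˡ-≤ 2 (begin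
      2 * n                 ≤⟨ ℕ.*-monoʳ-≤ 2 (ℕ.<⇒≤ tight) ⟩
      2 * (size + suc D)    ≡⟨ ℕ.*-distribˡ-+ 2 size (suc D) ⟩
      2 * size + 2 * suc D  ≤⟨ ℕ.+-mono-≤ small-core (ℕ.≤-trans small-line A≤A²) ⟩
      A ^ 2 + A ^ 2         ≡⟨ cong (_+_ (A ^ 2)) (ℕ.+-identityʳ (A ^ 2)) ⟨
      2 * A ^ 2             ∎)
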